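{- Let $T$ be a (finite) tree. Then $D(T)=D_{\ell}(T)$.
   Context: A coloring of a graph $G$ is a map $\phi:V(G)\to\mathbb{N}$; a $k$-coloring maps into $[k]=\{1,\dots,k\}$. A coloring is distinguishing if no nontrivial automorphism of $G$ preserves all vertex colors (i.e. there is no nonidentity automorphism $\sigma$ with $\phi(\sigma(v))=\phi(v)$ for all $v$). The distinguishing number $D(G)$ is the minimum number of colors in a distinguishing coloring of $G$. Given a list assignment $L=\{L(v)\}_{v\in V(G)}$, $G$ is $L$-distinguishable if there is a distinguishing coloring $f$ with $f(v)\in L(v)$ for all $v$. The list distinguishing number $D_\ell(G)$ is the minimum integer $k$ such that $G$ is $L$-distinguishable for every list assignment $L$ with $|L(v)|=k$ for all $v$. -}

module Defs where

open import Data.Nat using (ℕ; zero; suc; _≤_; _<_)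
open import Data.Fin using (Fin)
open import Data.Bool using (Bool; true; false)
open import Data.List using (List; []; _∷_; length; head; last)
open import Data.Maybe using (just)
open import Data.List.Membership.Propositional using (_∈_)
open import Data.List.Relation.Unary.Unique.Propositional using (Unique)
open import Data.List.Relation.Unary.Linked using (Linked)
open import Data.Product using (Σ; ∃; ∃-syntax; _×_; _,_)
open import Relation.Binary.PropositionalEquality using (_≡_; _≢_)
open import Relation.Nullary using (¬_)

record Graph (n : ℕ) : Set where
  field
    adj     : Fin n → Fin n → Bool
    symm    : ∀ u v → adj u v ≡ adj v u
    irrefl  : ∀ v → adj v v ≡ false

open Graph public

Adj : ∀ {n} → Graph n → Fin n → Fin n → Set
Adj G u v = adj G u v ≡ true

data Walk {n : ℕ} (G : Graph n) : Fin n → Fin n → Set where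
  here : ∀ {u} → Walk G u u
  step : ∀ {u w v} → Adj G u w → Walk G w v → Walk G u v

Connected : ∀ {n} → Graph n → Set
Connected {n} G = ∀ (u v : Fin n) → Walk G u v

IsCycle : ∀ {n} → Graph n → List (Fin n) → Set
IsCycle G vs =
  (3 ≤ length vs) × Unique vs × Linked (Adj G) vs ×
  (∃[ a ] ∃[ b ] (head vs ≡ just a × last vs ≡ just b × Adj G b a))

Acyclic : ∀ {n} → Graph n → Set
Acyclic {n} G = ∀ (vs : List (Fin n)) → ¬ IsCycle G vs

IsTree : ∀ {n} → Graph n → Set
IsTree {n} G = (1 ≤ n) × Connected G × Acyclic G

record Automorphism {n : ℕ} (G : Graph n) : Set where
  field
    to      : Fin n → Fin n
    from    : Fin n → Fin n
    to-from : ∀ v → to (from v) ≡ v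
    from-to : ∀ v → from (to v) ≡ v
    pres    : ∀ u v → adj G (to u) (to v) ≡ adj G u v

open Automorphism public

Distinguishing : ∀ {n} → Graph n → (Fin n → ℕ) → Set
Distinguishing {n} G φ =
  ∀ (σ : Automorphism G) → (∀ v → φ (to σ v) ≡ φ v) → ∀ v → to σ v ≡ v

IsKColoring : ∀ {n} → ℕ → (Fin n → ℕ) → Set
IsKColoring k φ = ∀ v → (1 ≤ φ v) × (φ v ≤ k)

HasDistKColoring : ∀ {n} → Graph n → ℕ → Set
HasDistKColoring {n} G k = ∃[ φ ] (IsKColoring {n} k φ × Distinguishing G φ)

ListAssignment : ℕ → Set
ListAssignment n = Fin n → List ℕ

LDistinguishable : ∀ {n} → Graph n → ListAssignment n → Set
LDistinguishable {n} G L = ∃[ f ] ((∀ v → f v ∈ L v) × Distinguishing G f)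

AllKListsDist : ∀ {n} → Graph n → ℕ → Set
AllKListsDist {n} G k =
  ∀ (L : ListAssignment n) → (∀ v → Unique (L v) × length (L v) ≡ k) →
  LDistinguishable G L

IsMinimum : (ℕ → Set) → ℕ → Set
IsMinimum P k = P k × (∀ j → P j → k ≤ j)

DistNumberIs : ∀ {n} → Graph n → ℕ → Set
DistNumberIs G k = IsMinimum (HasDistKColoring G) k

ListDistNumberIs : ∀ {n} → Graph n → ℕ → Set
ListDistNumberIs G k = IsMinimum (AllKListsDist G) k

{-# OPTIONS --safe #-}
module Submission where

open import Defs hiding (here; step)
open import Data.Bool using (Bool; true; false)
import Data.Bool.Properties as Bool
open import Data.Empty using (⊥)
open import Data.Fin using (Fin; zero)
open import Data.Fin.Properties using () renaming (_≟_ to _≟ᶠ_)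
open import Data.List using (List; []; _∷_; _++_; length; map; filter; zip; last; allFin; applyUpTo; deduplicate; cartesianProductWith)
open import Data.List.Properties
  using (map-++; map-∘; map-cong-local; map-id-local; length-++; length-filter; length-tabulate; length-applyUpTo;
         filter-all; filter-notAll; ++-cancelʳ; ++-cancelˡ; ++-identityʳ; ∷-injective; ∷-injectiveʳ)
open import Data.List.Membership.Propositional using (_∈_; _∉_; find; lose)
open import Data.List.Membership.Propositional.Properties
  using (∈-∃++; ∈-++⁺ˡ; ∈-++⁺ʳ; ∈-++⁻; ∈-map⁺; ∈-map⁻; ∈-filter⁺; ∈-filter⁻; ∈-allFin; ∈-applyUpTo⁺; ∈-applyUpTo⁻;
         ∈-cartesianProductWith⁺; ∈-cartesianProductWith⁻; ∈-deduplicate⁺; ∈-deduplicate⁻)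
open import Data.List.Membership.Propositional.Properties.WithK using (unique∧set⇒bag)
import Data.List.Membership.DecPropositional as DecMembership
open import Data.List.Relation.Binary.BagAndSetEquality using (∼bag⇒↭)
open import Data.List.Relation.Binary.Permutation.Propositional as Perm
  using (_↭_; prep; swap; ↭-refl; ↭-sym; ↭-trans; ↭-reflexive; ↭⇒↭ₛ)
open import Data.List.Relation.Binary.Permutation.Propositional.Properties
  using (shift; shifts; drop-∷; ∈-resp-↭; ¬x∷xs↭[]; map⁺; ++⁺; ++⁺ˡ)
import Data.List.Relation.Binary.Permutation.Setoid.Properties as Permₛ
open import Data.List.Relation.Binary.Pointwise using (Pointwise; []; _∷_; Pointwise-≡⇒≡)
open import Data.List.Relation.Unary.All as All using (All; []; _∷_)
import Data.List.Relation.Unary.All.Properties as Allₚ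
open import Data.List.Relation.Unary.AllPairs as AllPairs using (AllPairs; []; _∷_)
import Data.List.Relation.Unary.AllPairs.Properties as AllPairsₚ
open import Data.List.Relation.Unary.Any as Any using (here; there; any?)
open import Data.List.Relation.Unary.Linked using (Linked; [-]; _∷_)
open import Data.List.Relation.Unary.Sorted.TotalOrder.Properties using (↗↭↗⇒≋)
open import Data.List.Relation.Unary.Unique.Propositional using (Unique)
import Data.List.Relation.Unary.Unique.Propositional.Properties as Uniqueₚ
open import Data.Maybe as Maybe using (Maybe; just; nothing)
open import Data.Nat using (ℕ; zero; suc; _+_; _*_; _≤_; _<_; z≤n; s≤s; s≤s⁻¹; _≟_; _<?_)
open import Data.Nat.Properties
  using (≤-refl; ≤-reflexive; ≤-trans; ≤-antisym; ≤-totalOrder; ≤-decTotalOrder; <-trans; <-asym; <⇒≤; <⇒≢; ≤⇒≯; ≮⇒≥;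
         n≤1+n; suc-injective; +-suc; +-identityʳ; +-mono-<-≤; *-cancelˡ-≡; even≢odd; module ≤-Reasoning)
open import Data.Product using (∃-syntax; _×_; _,_; proj₁; proj₂)
open import Data.Sum using (_⊎_; inj₁; inj₂; [_,_]′)
open import Function using (_∘_; id; mk⇔)
open import Relation.Binary.Definitions using (DecidableEquality)
open import Relation.Binary.PropositionalEquality
  using (_≡_; _≢_; refl; sym; trans; cong; cong₂; subst; subst₂; setoid; module ≡-Reasoning)
open import Relation.Nullary using (¬_; yes; no; ¬?; contradiction)
open import Relation.Nullary.Decidable using (_×-dec_)

open import Data.List.Membership.DecPropositional _≟_ using (_∈?_)
open import Data.List.Relation.Unary.Unique.DecPropositional _≟_ using (unique?)
open import Data.List.Relation.Unary.Unique.DecPropositional.Properties _≟_ using (deduplicate-!)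
open import Data.List.Sort ≤-decTotalOrder using (sort; sort-↭; sort-↗)

-- The centroid of a tree (a vertex or an edge) is fixed by every automorphism, so the tree may be
-- rooted there. A colouring of a rooted tree is distinguishing iff it is rigid: the branches at
-- every vertex are pairwise non-isomorphic as coloured rooted trees. By induction, every list
-- assignment with lists of size k admits at least as many isomorphism classes of rigid colourings
-- as the k-colour palette does. In the induction step the classes at a vertex are transversals,
-- taken as sets, of the families of classes of its branches, where isomorphic branches have equal
-- families in the palette case. Fixing y in the first palette family and x in the first list
-- family, transversals through y (avoiding y) are matched with transversals through x (avoiding x).

-- Sibling branches need distinct classes, so one rigid colouring per branch is too weak an
-- induction hypothesis; the number of classes has to be carried. The obstacle is that, under lists,
-- branches isomorphic as uncoloured trees can have different, partially overlapping families.
-- Binomial counting then fails, and one set of classes may come from several transversals; hence an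
-- injection up to `↭`. Deleting x and y keeps the size inequality because a list family containing
-- x shares a class with the first one. The two uncoloured branches are then isomorphic, so the
-- palette family of that branch equals the first palette family and contains y as well. The same
-- rigidity on the palette side lets y be moved to the first position of any transversal that
-- contains it. Classes are encoded as natural numbers, so that isomorphism becomes equality and
-- families become lists to delete from.

-- Duplicate-free lists and comparison of lengths

Unique-resp-↭ : ∀ {A : Set} {xs ys : List A} → xs ↭ ys → Unique xs → Unique ys
Unique-resp-↭ p = Permₛ.Unique-resp-↭ (setoid _) (↭⇒↭ₛ p)

∈⇒↭∷ : ∀ {A : Set} {x : A} {xs} → x ∈ xs → ∃[ ys ] xs ↭ x ∷ ys
∈⇒↭∷ {x = x} x∈xs with ∈-∃++ x∈xs
... | as , bs , refl = as ++ bs , shift x as bs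

-- The partner of the head is struck from `ys`; by injectivity no later entry of `xs` relates to it.
length-≤-injective : ∀ {A B : Set} {xs : List A} {ys : List B} (R : A → B → Set) →
  Unique xs → (∀ {x} → x ∈ xs → ∃[ y ] (y ∈ ys × R x y)) →
  (∀ {x x′ y} → R x y → R x′ y → x ≡ x′) → length xs ≤ length ys
length-≤-injective R [] total inj = z≤n
length-≤-injective {xs = x ∷ xs} {ys} R (x∉ ∷ uniq) total inj with total (here refl)
... | y , y∈ys , Rxy with ∈-∃++ y∈ys
... | as , bs , refl = begin
  suc (length xs)           ≤⟨ s≤s (length-≤-injective R uniq total′ inj) ⟩
  suc (length (as ++ bs))   ≡⟨ cong suc (length-++ as) ⟩
  suc (length as + length bs) ≡⟨ +-suc (length as) (length bs) ⟨
  length as + length (y ∷ bs) ≡⟨ length-++ as ⟨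
  length (as ++ y ∷ bs)     ∎
  where
  open ≤-Reasoning
  total′ : ∀ {z} → z ∈ xs → ∃[ w ] (w ∈ as ++ bs × R z w)
  total′ {z} z∈ with total (there z∈)
  ... | w , w∈ , Rzw with ∈-++⁻ as w∈
  ... | inj₁ w∈as = w , ∈-++⁺ˡ w∈as , Rzw
  ... | inj₂ (there w∈bs) = w , ∈-++⁺ʳ as w∈bs , Rzw
  ... | inj₂ (here refl) = contradiction (inj Rxy Rzw) (All.lookup x∉ z∈)

length-≤-⊆ : ∀ {A : Set} {xs ys : List A} → Unique xs → (∀ {x} → x ∈ xs → x ∈ ys) →
  length xs ≤ length ys
length-≤-⊆ uniq sub =
  length-≤-injective _≡_ uniq (λ x∈ → _ , sub x∈ , refl) (λ p q → trans p (sym q))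

-- Codes of finite multisets

-- pair m n = 2 ^ m * (2 * n + 1)
pair : ℕ → ℕ → ℕ
pair zero    n = suc (2 * n)
pair (suc m) n = 2 * pair m n

pair≢0 : ∀ m n → pair m n ≢ 0
pair≢0 zero    n ()
pair≢0 (suc m) n eq = pair≢0 m n (*-cancelˡ-≡ _ 0 2 eq)

pair-injective : ∀ m n m′ n′ → pair m n ≡ pair m′ n′ → m ≡ m′ × n ≡ n′
pair-injective zero    n zero     n′ eq = refl , *-cancelˡ-≡ n n′ 2 (suc-injective eq)
pair-injective zero    n (suc m′) n′ eq = contradiction (sym eq) (even≢odd (pair m′ n′) n)
pair-injective (suc m) n zero     n′ eq = contradiction eq (even≢odd (pair m n) n′)
pair-injective (suc m) n (suc m′) n′ eq with pair-injective m n m′ n′ (*-cancelˡ-≡ _ _ 2 eq)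
... | refl , n≡n′ = refl , n≡n′

listCode : List ℕ → ℕ
listCode []       = 0
listCode (x ∷ xs) = pair x (listCode xs)

listCode-injective : ∀ xs ys → listCode xs ≡ listCode ys → xs ≡ ys
listCode-injective []       []       eq = refl
listCode-injective []       (y ∷ ys) eq = contradiction (sym eq) (pair≢0 y _)
listCode-injective (x ∷ xs) []       eq = contradiction eq (pair≢0 x _)
listCode-injective (x ∷ xs) (y ∷ ys) eq with pair-injective x _ y _ eq
... | refl , eq′ = cong (x ∷_) (listCode-injective xs ys eq′)

multisetCode : List ℕ → ℕ
multisetCode xs = listCode (sort xs)

multisetCode-cong : ∀ {xs ys} → xs ↭ ys → multisetCode xs ≡ multisetCode ys
multisetCode-cong {xs} {ys} p = cong listCode (Pointwise-≡⇒≡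
  (↗↭↗⇒≋ ≤-totalOrder (sort-↗ xs) (sort-↗ ys)
    (↭⇒↭ₛ (↭-trans (sort-↭ xs) (↭-trans p (↭-sym (sort-↭ ys)))))))

multisetCode-injective : ∀ {xs ys} → multisetCode xs ≡ multisetCode ys → xs ↭ ys
multisetCode-injective {xs} {ys} eq = ↭-trans (↭-sym (sort-↭ xs))
  (↭-trans (↭-reflexive (listCode-injective _ _ eq)) (sort-↭ ys))

-- Transversals

infixl 6 _∖_
_∖_ : List ℕ → ℕ → List ℕ
xs ∖ x = filter (λ y → ¬? (y ≟ x)) xs

∈-∖⁺ : ∀ {x y xs} → y ∈ xs → y ≢ x → y ∈ xs ∖ x
∈-∖⁺ = ∈-filter⁺ _

∈-∖⁻ : ∀ {x y} xs → y ∈ xs ∖ x → y ∈ xs × y ≢ x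
∈-∖⁻ xs = ∈-filter⁻ _ {xs = xs}

length-∖-< : ∀ {x xs} → x ∈ xs → length (xs ∖ x) < length xs
length-∖-< {x} {xs} x∈ = filter-notAll _ xs (Any.map (λ x≡y y≢x → y≢x (sym x≡y)) x∈)

length-∖-≥ : ∀ {xs} x → Unique xs → length xs ≤ suc (length (xs ∖ x))
length-∖-≥ {xs} x uniq = length-≤-⊆ {ys = x ∷ xs ∖ x} uniq λ {y} → sub y
  where
  sub : ∀ y → y ∈ xs → y ∈ x ∷ xs ∖ x
  sub y y∈ with y ≟ x
  ... | yes refl = here refl
  ... | no y≢x   = there (∈-∖⁺ y∈ y≢x)

Transversal : List (List ℕ) → List ℕ → Set
Transversal Xs xs = Pointwise _∈_ xs Xs × Unique xs

-- A total relation suffices for counting, so `Rel` need not be functional. Injectivity is up to `↭`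
-- on both sides because transversals are compared as sets.
record TransversalInjection (Bs As : List (List ℕ)) : Set₁ where
  field
    Rel       : List ℕ → List ℕ → Set
    total     : ∀ {zs} → Transversal Bs zs → ∃[ xs ] (Transversal As xs × Rel zs xs)
    injective : ∀ {zs zs′ xs xs′} → Rel zs xs → Rel zs′ xs′ → xs ↭ xs′ → zs ↭ zs′

infix 4 _⊆_ _≐_
_⊆_ _≐_ : List ℕ → List ℕ → Set
xs ⊆ ys = ∀ {x} → x ∈ xs → x ∈ ys
xs ≐ ys = xs ⊆ ys × ys ⊆ xs

Larger : List ℕ × List ℕ → Set
Larger (A , B) = Unique A × length B ≤ length A

-- In use, A and B are the list classes and the palette classes of one branch. The first clause
-- preserves `Larger` under deletion, the second permits exchanges. Both conclude about palette
-- families only, since list families of isomorphic branches may differ.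
Compatible : List ℕ × List ℕ → List ℕ × List ℕ → Set
Compatible (A , B) (A′ , B′) =
  (∀ {x} → x ∈ A → x ∈ A′ → B ≐ B′) × (∀ {y} → y ∈ B → y ∈ B′ → B ≐ B′)

delete : ℕ → ℕ → List ℕ × List ℕ → List ℕ × List ℕ
delete x y (A , B) = A ∖ x , B ∖ y

-- The hypothesis excludes the one bad case, A losing an entry while B loses none. If B does lose
-- one, A loses at most one, being duplicate-free.
delete-larger : ∀ {x y} P → Larger P → (x ∈ proj₁ P → y ∈ proj₂ P) → Larger (delete x y P)
delete-larger {x} {y} (A , B) (uniq , len) imp = Uniqueₚ.filter⁺ _ uniq , le
  where
  open ≤-Reasoning
  le : length (B ∖ y) ≤ length (A ∖ x)
  le with y ∈? B
  ... | yes y∈B = s≤s⁻¹ (begin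
    suc (length (B ∖ y)) ≤⟨ length-∖-< y∈B ⟩
    length B             ≤⟨ len ⟩
    length A             ≤⟨ length-∖-≥ x uniq ⟩
    suc (length (A ∖ x)) ∎)
  ... | no y∉B = begin
    length (B ∖ y) ≤⟨ length-filter _ B ⟩
    length B       ≤⟨ len ⟩
    length A       ≡⟨ cong length (filter-all (λ z → ¬? (z ≟ x)) (All.tabulate λ z∈A z≡x →
                        y∉B (imp (subst (_∈ A) z≡x z∈A)))) ⟨
    length (A ∖ x) ∎

∖-≐ : ∀ {B B′} y → B ≐ B′ → (B ∖ y) ≐ (B′ ∖ y)
∖-≐ {B} {B′} y (f , g) =
  (λ z∈ → let z∈B , z≢y = ∈-∖⁻ B z∈ in ∈-∖⁺ (f z∈B) z≢y) ,
  (λ z∈ → let z∈B , z≢y = ∈-∖⁻ B′ z∈ in ∈-∖⁺ (g z∈B) z≢y)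

delete-compatible : ∀ {x y} P Q → Compatible P Q → Compatible (delete x y P) (delete x y Q)
delete-compatible {x} {y} (A , B) (A′ , B′) (c , d) =
  (λ z∈ z∈′ → ∖-≐ y (c (proj₁ (∈-∖⁻ A z∈)) (proj₁ (∈-∖⁻ A′ z∈′)))) ,
  (λ z∈ z∈′ → ∖-≐ y (d (proj₁ (∈-∖⁻ B z∈)) (proj₁ (∈-∖⁻ B′ z∈′))))

transversal-∖⁺ : ∀ {y zs Xs} → Pointwise _∈_ zs Xs → y ∉ zs → Pointwise _∈_ zs (map (_∖ y) Xs)
transversal-∖⁺ []          y∉ = []
transversal-∖⁺ (z∈ ∷ rest) y∉ =
  ∈-∖⁺ z∈ (λ z≡y → y∉ (here (sym z≡y))) ∷ transversal-∖⁺ rest (y∉ ∘ there)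

transversal-∖⁻ : ∀ {y zs} Xs → Pointwise _∈_ zs (map (_∖ y) Xs) → Pointwise _∈_ zs Xs × y ∉ zs
transversal-∖⁻ []       [] = [] , λ ()
transversal-∖⁻ (X ∷ Xs) (z∈ ∷ rest) with ∈-∖⁻ X z∈ | transversal-∖⁻ Xs rest
... | z∈X , z≢y | rest′ , y∉ = z∈X ∷ rest′ , λ { (here y≡z) → z≢y (sym y≡z) ; (there p) → y∉ p }

-- z takes over the position of y, whose family also contains z.
exchange : ∀ {y z : ℕ} {zs Xs} → Pointwise _∈_ zs Xs → y ∈ zs → All (λ X → y ∈ X → z ∈ X) Xs →
  ∃[ zs′ ] (z ∷ zs ↭ y ∷ zs′ × Pointwise _∈_ zs′ Xs)
exchange {y} {z} {_ ∷ zs} (w∈ ∷ rest) (here refl) (f ∷ _) =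
  z ∷ zs , swap z y ↭-refl , f w∈ ∷ rest
exchange {y} {z} {w ∷ zs} (w∈ ∷ rest) (there y∈) (_ ∷ fs) with exchange rest y∈ fs
... | zs′ , p , rest′ =
  w ∷ zs′ , ↭-trans (swap z w ↭-refl) (↭-trans (prep w p) (swap w y ↭-refl)) , w∈ ∷ rest′

-- If y was chosen from a later family, that family includes `B₁`, so y can trade places with the
-- entry chosen from `B₁`; what remains is a transversal of `Bs` avoiding y. Its image gets x put in
-- front. Images of the two kinds never collide, since only one kind contains x.
split-injection : ∀ {A₁ B₁ Bs As x y} → x ∈ A₁ → y ∈ B₁ → All (λ B → y ∈ B → B₁ ⊆ B) Bs →
  TransversalInjection (map (_∖ y) Bs) (map (_∖ x) As) →
  TransversalInjection (map (_∖ y) (B₁ ∷ Bs)) (map (_∖ x) (A₁ ∷ As)) →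
  TransversalInjection (B₁ ∷ Bs) (A₁ ∷ As)
split-injection {A₁} {B₁} {Bs} {As} {x} {y} x∈A₁ y∈B₁ sub through avoiding = record
  { Rel = Rel′ ; total = total′ ; injective = injective′ }
  where
  open TransversalInjection
  Rel′ : List ℕ → List ℕ → Set
  Rel′ zs xs =
    (∃[ zs′ ] ∃[ xs′ ] (zs ↭ y ∷ zs′ × xs ≡ x ∷ xs′ × Rel through zs′ xs′)) ⊎
    (x ∉ xs × Rel avoiding zs xs)

  extract : ∀ {zs} → Pointwise _∈_ zs (B₁ ∷ Bs) → y ∈ zs →
    ∃[ zs′ ] (zs ↭ y ∷ zs′ × Pointwise _∈_ zs′ Bs)
  extract {z ∷ zs} (z∈ ∷ rest) (here refl) = zs , ↭-refl , rest
  extract {z ∷ zs} (z∈ ∷ rest) (there y∈)  = exchange rest y∈ (All.map (λ f y∈B → f y∈B z∈) sub)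

  total′ : ∀ {zs} → Transversal (B₁ ∷ Bs) zs → ∃[ xs ] (Transversal (A₁ ∷ As) xs × Rel′ zs xs)
  total′ {zs} (pw , uniq) with y ∈? zs
  ... | no y∉ with total avoiding (transversal-∖⁺ pw y∉ , uniq)
  ... | xs , (pw′ , uniq′) , r with transversal-∖⁻ (A₁ ∷ As) pw′
  ... | pw″ , x∉ = xs , (pw″ , uniq′) , inj₂ (x∉ , r)
  total′ {zs} (pw , uniq) | yes y∈ with extract pw y∈
  ... | zs′ , p , pw₁ with Unique-resp-↭ p uniq
  ... | uniq₁@(_ ∷ uniq₂)
    with total through (transversal-∖⁺ pw₁ (Uniqueₚ.Unique[x∷xs]⇒x∉xs uniq₁) , uniq₂)
  ... | xs , (pw′ , uniq′) , r with transversal-∖⁻ As pw′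
  ... | pw″ , x∉ =
    x ∷ xs , (x∈A₁ ∷ pw″ , Allₚ.¬Any⇒All¬ xs x∉ ∷ uniq′) , inj₁ (zs′ , xs , p , refl , r)

  injective′ : ∀ {zs zs′ xs xs′} → Rel′ zs xs → Rel′ zs′ xs′ → xs ↭ xs′ → zs ↭ zs′
  injective′ (inj₁ (_ , _ , p , refl , r)) (inj₁ (_ , _ , p′ , refl , r′)) q =
    ↭-trans p (↭-trans (prep y (injective through r r′ (drop-∷ q))) (↭-sym p′))
  injective′ (inj₁ (_ , _ , p , refl , r)) (inj₂ (x∉ , r′)) q =
    contradiction (∈-resp-↭ q (here refl)) x∉
  injective′ (inj₂ (x∉ , r)) (inj₁ (_ , _ , p′ , refl , r′)) q =
    contradiction (∈-resp-↭ (↭-sym q) (here refl)) x∉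
  injective′ (inj₂ (_ , r)) (inj₂ (_ , r′)) q = injective avoiding r r′ q

map-delete : ∀ {x y} Ps →
  map proj₁ (map (delete x y) Ps) ≡ map (_∖ x) (map proj₁ Ps) ×
  map proj₂ (map (delete x y) Ps) ≡ map (_∖ y) (map proj₂ Ps)
map-delete []       = refl , refl
map-delete (P ∷ Ps) with map-delete Ps
... | eq₁ , eq₂ = cong (_ ∷_) eq₁ , cong (_ ∷_) eq₂

delete-all : ∀ {x y} Ps → All Larger Ps → All (λ P → x ∈ proj₁ P → y ∈ proj₂ P) Ps →
  All Larger (map (delete x y) Ps)
delete-all []       []       []       = []
delete-all (P ∷ Ps) (l ∷ ls) (i ∷ is) = delete-larger P l i ∷ delete-all Ps ls is

transversal-injection : ∀ Ps → All Larger Ps → AllPairs Compatible Ps →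
  TransversalInjection (map proj₂ Ps) (map proj₁ Ps)
transversal-injection Ps = go (length Ps) _ Ps refl ≤-refl
  where
  firstSize : List (List ℕ × List ℕ) → ℕ
  firstSize []            = 0
  firstSize ((_ , B) ∷ _) = length B

  length-delete : ∀ {x y} Ps → length (map (delete x y) Ps) ≡ length Ps
  length-delete []       = refl
  length-delete (_ ∷ Ps) = cong suc (length-delete Ps)

  deleted : ∀ {x y} Ps →
    TransversalInjection (map proj₂ (map (delete x y) Ps)) (map proj₁ (map (delete x y) Ps)) →
    TransversalInjection (map (_∖ y) (map proj₂ Ps)) (map (_∖ x) (map proj₁ Ps))
  deleted Ps = subst₂ TransversalInjection (proj₂ (map-delete Ps)) (proj₁ (map-delete Ps))

  -- Lexicographic induction: transversals through y drop a pair and reset `b`; transversals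
  -- avoiding y keep the number of pairs and shrink the first palette family.
  go : ∀ m b Ps → length Ps ≡ m → firstSize Ps ≤ b → All Larger Ps → AllPairs Compatible Ps →
    TransversalInjection (map proj₂ Ps) (map proj₁ Ps)
  go m b [] _ _ _ _ = record
    { Rel = λ zs xs → zs ≡ []
    ; total = λ { ([] , _) → [] , ([] , []) , refl }
    ; injective = λ { refl refl _ → ↭-refl } }
  go m b ((A , []) ∷ Ps) _ _ _ _ = record
    { Rel = λ _ _ → ⊥
    ; total = λ { (() ∷ _ , _) }
    ; injective = λ () }
  go m b (([] , y ∷ B) ∷ Ps) _ _ ((_ , ()) ∷ _) _
  go (suc m) (suc b) Ps₀@((A₁@(x ∷ A) , B₁@(y ∷ B)) ∷ Ps) len (s≤s B≤b)
     larger@(_ ∷ larger′) compat@(compat₁ ∷ compat′) =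
    split-injection (here refl) (here refl)
      (Allₚ.map⁺ (All.map (λ c y∈ → proj₁ (proj₂ c (here refl) y∈)) compat₁))
      (deleted Ps (go m _ (map (delete x y) Ps) (trans (length-delete Ps) (suc-injective len)) ≤-refl
        (delete-all Ps larger′ imp) (AllPairsₚ.map⁺ (AllPairs.map (delete-compatible _ _) compat′))))
      (deleted Ps₀ (go (suc m) b (map (delete x y) Ps₀) (trans (length-delete Ps₀) len)
        (≤-trans (s≤s⁻¹ (length-∖-< {xs = B₁} (here refl))) B≤b)
        (delete-all Ps₀ larger ((λ _ → here refl) ∷ imp))
        (AllPairsₚ.map⁺ (AllPairs.map (delete-compatible _ _) compat))))
    where
    imp : All (λ P → x ∈ proj₁ P → y ∈ proj₂ P) Ps
    imp = All.map (λ c x∈ → proj₁ (proj₁ c (here refl) x∈) (here refl)) compat₁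

Unique-++⁻ : ∀ {A : Set} (xs : List A) {ys} → Unique (xs ++ ys) →
  Unique xs × Unique ys × (∀ {x} → x ∈ xs → x ∉ ys)
Unique-++⁻ []       uniq = [] , uniq , λ ()
Unique-++⁻ (x ∷ xs) (x∉ ∷ uniq) with Unique-++⁻ xs uniq
... | ux , uy , disj = Allₚ.++⁻ˡ xs x∉ ∷ ux , uy ,
  λ { (here refl) y∈ → All.lookup (Allₚ.++⁻ʳ xs x∉) y∈ refl ; (there p) → disj p }

-- Rooted trees

data Tree (A : Set) : Set where
  node : A → List (Tree A) → Tree A

Forest : Set → Set
Forest A = List (Tree A)

mapT : ∀ {A B} → (A → B) → Tree A → Tree B
mapF : ∀ {A B} → (A → B) → Forest A → Forest B
mapT f (node v ts) = node (f v) (mapF f ts)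
mapF f []       = []
mapF f (t ∷ ts) = mapT f t ∷ mapF f ts

flatT : ∀ {A} → Tree A → List A
flatF : ∀ {A} → Forest A → List A
flatT (node v ts) = v ∷ flatF ts
flatF []       = []
flatF (t ∷ ts) = flatT t ++ flatF ts

data ZipT {A B : Set} (S : A → B → Set) : Tree A → Tree B → Set
data ZipF {A B : Set} (S : A → B → Set) : Forest A → Forest B → Set
data ZipT S where
  node : ∀ {a b ts us} → S a b → ZipF S ts us → ZipT S (node a ts) (node b us)
data ZipF S where
  []  : ZipF S [] []
  _∷_ : ∀ {t u ts us} → ZipT S t u → ZipF S ts us → ZipF S (t ∷ ts) (u ∷ us)

mapT-cong : ∀ {A B} {f g : A → B} t → (∀ {v} → v ∈ flatT t → f v ≡ g v) → mapT f t ≡ mapT g t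
mapF-cong : ∀ {A B} {f g : A → B} ts → (∀ {v} → v ∈ flatF ts → f v ≡ g v) → mapF f ts ≡ mapF g ts
mapT-cong (node v ts) eq = cong₂ node (eq (here refl)) (mapF-cong ts (eq ∘ there))
mapF-cong []       eq = refl
mapF-cong (t ∷ ts) eq =
  cong₂ _∷_ (mapT-cong t (eq ∘ ∈-++⁺ˡ)) (mapF-cong ts (eq ∘ ∈-++⁺ʳ (flatT t)))

module _ {A B : Set} (_≟ᴬ_ : DecidableEquality A) (b₀ : B) {S : A → B → Set} where
  open DecMembership _≟ᴬ_ using () renaming (_∈?_ to _∈ᴬ?_)

  -- Distinct labels on the left make the positionwise correspondence a well-defined function of
  -- labels.
  relabelT : ∀ {t u} → Unique (flatT t) → ZipT S t u →
    ∃[ f ] (mapT f t ≡ u × (∀ {v} → v ∈ flatT t → S v (f v)))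
  relabelF : ∀ {ts us} → Unique (flatF ts) → ZipF S ts us →
    ∃[ f ] (mapF f ts ≡ us × (∀ {v} → v ∈ flatF ts → S v (f v)))
  relabelT {node v ts} {node b us} (v∉ ∷ uniq) (node s z) with relabelF uniq z
  ... | f , refl , fs = g , cong₂ node g-v (mapF-cong ts g-other) , gs
    where
    g : A → B
    g x with x ≟ᴬ v
    ... | yes _ = b
    ... | no  _ = f x
    g-v : g v ≡ b
    g-v with v ≟ᴬ v
    ... | yes _ = refl
    ... | no v≢v = contradiction refl v≢v
    g-other : ∀ {x} → x ∈ flatF ts → g x ≡ f x
    g-other {x} x∈ with x ≟ᴬ v
    ... | yes refl = contradiction refl (All.lookup v∉ x∈)
    ... | no _ = refl
    gs : ∀ {x} → x ∈ v ∷ flatF ts → S x (g x)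
    gs (here refl) = subst (S v) (sym g-v) s
    gs (there x∈) = subst (S _) (sym (g-other x∈)) (fs x∈)
  -- No label occurs here, so any value serves.
  relabelF {[]} _ [] = (λ _ → b₀) , refl , λ ()
  relabelF {t ∷ ts} uniq (z ∷ zs) with Unique-++⁻ (flatT t) uniq
  ... | uniq₁ , uniq₂ , disj with relabelT uniq₁ z | relabelF uniq₂ zs
  ... | f₁ , refl , fs₁ | f₂ , refl , fs₂ =
    g , cong₂ _∷_ (mapT-cong t g-left) (mapF-cong ts g-right) , gs
    where
    g : A → B
    g x with x ∈ᴬ? flatT t
    ... | yes _ = f₁ x
    ... | no  _ = f₂ x
    g-left : ∀ {x} → x ∈ flatT t → g x ≡ f₁ x
    g-left {x} x∈ with x ∈ᴬ? flatT t
    ... | yes _ = refl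
    ... | no x∉ = contradiction x∈ x∉
    g-right : ∀ {x} → x ∈ flatF ts → g x ≡ f₂ x
    g-right {x} x∈ with x ∈ᴬ? flatT t
    ... | yes x∈t = contradiction x∈ (disj x∈t)
    ... | no _ = refl
    gs : ∀ {x} → x ∈ flatT t ++ flatF ts → S x (g x)
    gs x∈ with ∈-++⁻ (flatT t) x∈
    ... | inj₁ p = subst (S _) (sym (g-left p)) (fs₁ p)
    ... | inj₂ p = subst (S _) (sym (g-right p)) (fs₂ p)

-- Isomorphism classes of coloured trees

code  : Tree ℕ → ℕ
codeF : Forest ℕ → List ℕ
code (node a us) = pair a (multisetCode (codeF us))
codeF []       = []
codeF (u ∷ us) = code u ∷ codeF us

data Rigid : Tree ℕ → Set where
  node : ∀ {a us} → All Rigid us → Unique (codeF us) → Rigid (node a us)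

RigidF : Forest ℕ → Set
RigidF us = All Rigid us × Unique (codeF us)

choices : List (List ℕ) → List (List ℕ)
choices []       = [] ∷ []
choices (X ∷ Xs) = cartesianProductWith _∷_ X (choices Xs)

∈-choices⁺ : ∀ {Xs xs} → Pointwise _∈_ xs Xs → xs ∈ choices Xs
∈-choices⁺ []       = here refl
∈-choices⁺ (p ∷ ps) = ∈-cartesianProductWith⁺ _∷_ p (∈-choices⁺ ps)

∈-choices⁻ : ∀ Xs {xs} → xs ∈ choices Xs → Pointwise _∈_ xs Xs
∈-choices⁻ []       (here refl) = []
∈-choices⁻ (X ∷ Xs) p with ∈-cartesianProductWith⁻ _∷_ X (choices Xs) p
... | x , xs , x∈ , xs∈ , refl = x∈ ∷ ∈-choices⁻ Xs xs∈

-- codes L t lists the isomorphism classes of rigid colourings of t with colours from L.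
codes  : ∀ {A} → (A → List ℕ) → Tree A → List ℕ
codesF : ∀ {A} → (A → List ℕ) → Forest A → List (List ℕ)
codes L (node v ts) = deduplicate _≟_
  (cartesianProductWith pair (L v) (map multisetCode (filter unique? (choices (codesF L ts)))))
codesF L []       = []
codesF L (t ∷ ts) = codes L t ∷ codesF L ts

codes-unique : ∀ {A} (L : A → List ℕ) t → Unique (codes L t)
codes-unique L (node v ts) = deduplicate-! _

module _ {A : Set} (L : A → List ℕ) where

  ∈-codes⁺ : ∀ {v ts a xs} → a ∈ L v → Transversal (codesF L ts) xs →
    pair a (multisetCode xs) ∈ codes L (node v ts)
  ∈-codes⁺ a∈ (pw , uniq) = ∈-deduplicate⁺ _≟_ (∈-cartesianProductWith⁺ pair a∈
    (∈-map⁺ multisetCode (∈-filter⁺ unique? (∈-choices⁺ pw) uniq)))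

  ∈-codes⁻ : ∀ {v} ts {x} → x ∈ codes L (node v ts) → ∃[ a ] ∃[ xs ]
    (a ∈ L v × Transversal (codesF L ts) xs × x ≡ pair a (multisetCode xs))
  ∈-codes⁻ {v} ts x∈
    with ∈-cartesianProductWith⁻ pair (L v) _ (∈-deduplicate⁻ _≟_ (cartesianProductWith pair (L v) _) x∈)
  ... | a , y , a∈ , y∈ , refl with ∈-map⁻ multisetCode y∈
  ... | xs , xs∈ , refl with ∈-filter⁻ unique? {xs = choices (codesF L ts)} xs∈
  ... | xs∈′ , uniq = a , xs , a∈ , (∈-choices⁻ (codesF L ts) xs∈′ , uniq) , refl

  Colouring : A → ℕ → Set
  Colouring v a = a ∈ L v

  rigid⇒∈codes : ∀ {t u} → ZipT Colouring t u → Rigid u → code u ∈ codes L t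
  rigid⇒transversal : ∀ {ts us} → ZipF Colouring ts us → All Rigid us →
    Pointwise _∈_ (codeF us) (codesF L ts)
  rigid⇒∈codes (node a∈ z) (node rs uniq) = ∈-codes⁺ a∈ (rigid⇒transversal z rs , uniq)
  rigid⇒transversal []       []       = []
  rigid⇒transversal (z ∷ zs) (r ∷ rs) = rigid⇒∈codes z r ∷ rigid⇒transversal zs rs

  ∈codes⇒rigid : ∀ t {x} → x ∈ codes L t → ∃[ u ] (ZipT Colouring t u × Rigid u × code u ≡ x)
  transversal⇒rigid : ∀ ts {xs} → Pointwise _∈_ xs (codesF L ts) →
    ∃[ us ] (ZipF Colouring ts us × All Rigid us × codeF us ≡ xs)
  ∈codes⇒rigid (node v ts) x∈ with ∈-codes⁻ ts x∈
  ... | a , xs , a∈ , (pw , uniq) , refl with transversal⇒rigid ts pw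
  ... | us , z , rs , refl = node a us , node a∈ z , node rs uniq , refl
  transversal⇒rigid []       []       = [] , [] , [] , refl
  transversal⇒rigid (t ∷ ts) (p ∷ ps) with ∈codes⇒rigid t p | transversal⇒rigid ts ps
  ... | u , z , r , refl | us , zs , rs , refl = u ∷ us , z ∷ zs , r ∷ rs , refl

-- Comparing the numbers of list classes and palette classes

module _ {A : Set} (K : List ℕ) (L : A → List ℕ) where

  private
    Kᶜ : A → List ℕ
    Kᶜ _ = K

  -- The same position is struck from both choices, so the remainders are again choices for one
  -- common forest. The recursion that uses this descends along the other forest.
  pick : ∀ {x} ts {xs ys} → x ∈ xs →
    Pointwise _∈_ xs (codesF L ts) → Pointwise _∈_ ys (codesF Kᶜ ts) →
    ∃[ t ] ∃[ y ] ∃[ ts′ ] ∃[ xs′ ] ∃[ ys′ ]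
      (xs ↭ x ∷ xs′ × ys ↭ y ∷ ys′ × x ∈ codes L t × y ∈ codes Kᶜ t ×
       Pointwise _∈_ xs′ (codesF L ts′) × Pointwise _∈_ ys′ (codesF Kᶜ ts′))
  pick (t ∷ ts) (here refl) (p ∷ ps) (q ∷ qs) =
    t , _ , ts , _ , _ , ↭-refl , ↭-refl , p , q , ps , qs
  pick (t ∷ ts) (there x∈) (p ∷ ps) (q ∷ qs) with pick ts x∈ ps qs
  ... | t′ , y , ts′ , xs′ , ys′ , α , β , p′ , q′ , ps′ , qs′ =
    t′ , y , t ∷ ts′ , _ , _ , ↭-trans (prep _ α) (swap _ _ ↭-refl) ,
    ↭-trans (prep _ β) (swap _ _ ↭-refl) , p′ , q′ , p ∷ ps′ , q ∷ qs′

  -- A common class forces t and u to be isomorphic as uncoloured trees.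
  common-code : ∀ t u {x y} → x ∈ codes L t → x ∈ codes L u → y ∈ codes Kᶜ t → y ∈ codes Kᶜ u
  common-codeF : ∀ ts us {xs xs′ ys} → xs ↭ xs′ →
    Pointwise _∈_ xs (codesF L ts) → Pointwise _∈_ xs′ (codesF L us) →
    Pointwise _∈_ ys (codesF Kᶜ ts) → ∃[ ys′ ] (ys ↭ ys′ × Pointwise _∈_ ys′ (codesF Kᶜ us))
  common-code (node v ts) (node w us) x∈t x∈u y∈t
    with ∈-codes⁻ L ts x∈t | ∈-codes⁻ L us x∈u | ∈-codes⁻ Kᶜ {v} ts y∈t
  ... | a , xs , _ , (pw , _) , refl | a′ , xs′ , _ , (pw′ , _) , eq
      | b , ys , b∈ , (qw , uniq) , refl
    with common-codeF ts us (multisetCode-injective (proj₂ (pair-injective a _ a′ _ eq))) pw pw′ qw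
  ... | ys′ , α , qw′ =
    subst (_∈ codes Kᶜ (node w us)) (cong (pair b) (sym (multisetCode-cong α)))
      (∈-codes⁺ Kᶜ {w} b∈ (qw′ , Unique-resp-↭ α uniq))
  common-codeF [] [] α [] [] [] = [] , ↭-refl , []
  common-codeF (t ∷ ts) [] α (_ ∷ _) [] _ = contradiction α ¬x∷xs↭[]
  common-codeF ts (u ∷ us) α ps (p ∷ ps′) qs
    with pick ts (∈-resp-↭ (↭-sym α) (here refl)) ps qs
  ... | t , y , ts₁ , xs₁ , ys₁ , β , γ , x∈t , y∈t , ps₁ , qs₁
    with common-codeF ts₁ us (drop-∷ (↭-trans (↭-sym β) α)) ps₁ ps′ qs₁
  ... | ys′ , δ , qs′ =
    y ∷ ys′ , ↭-trans γ (prep y δ) , common-code t u x∈t p y∈t ∷ qs′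

∈-zip : ∀ {A B : Set} {xs : List A} {ys : List B} → length xs ≤ length ys →
  ∀ {x} → x ∈ xs → ∃[ y ] (y ∈ ys × (x , y) ∈ zip xs ys)
∈-zip {xs = _ ∷ _} {y ∷ _} (s≤s le) (here refl) = y , here refl , here refl
∈-zip {xs = _ ∷ _} {_ ∷ _} (s≤s le) (there x∈) with ∈-zip le x∈
... | y , y∈ , xy∈ = y , there y∈ , there xy∈

∈-zip⁻ : ∀ {A B : Set} (xs : List A) {ys : List B} {x y} → (x , y) ∈ zip xs ys → y ∈ ys
∈-zip⁻ (_ ∷ xs) {_ ∷ _} (here refl) = here refl
∈-zip⁻ (_ ∷ xs) {_ ∷ _} (there p)   = there (∈-zip⁻ xs p)

zip-injective : ∀ {A B : Set} (xs : List A) {ys : List B} {x x′ y} → Unique ys →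
  (x , y) ∈ zip xs ys → (x′ , y) ∈ zip xs ys → x ≡ x′
zip-injective (_ ∷ xs) {_ ∷ _} _ (here refl) (here refl) = refl
zip-injective (_ ∷ xs) {_ ∷ _} (y∉ ∷ _) (here refl) (there q) =
  contradiction refl (All.lookup y∉ (∈-zip⁻ xs q))
zip-injective (_ ∷ xs) {_ ∷ _} (y∉ ∷ _) (there p) (here refl) =
  contradiction refl (All.lookup y∉ (∈-zip⁻ xs p))
zip-injective (_ ∷ xs) {_ ∷ _} (_ ∷ uniq) (there p) (there q) = zip-injective xs uniq p q

module _ {A : Set} (K : List ℕ) (L : A → List ℕ)
         (L-unique : ∀ v → Unique (L v)) (L-length : ∀ v → length K ≤ length (L v)) where

  private
    Kᶜ : A → List ℕ
    Kᶜ _ = K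

    setsOf : Tree A → List ℕ × List ℕ
    setsOf t = codes L t , codes Kᶜ t

    map-setsOf : ∀ ts → map proj₁ (map setsOf ts) ≡ codesF L ts ×
                        map proj₂ (map setsOf ts) ≡ codesF Kᶜ ts
    map-setsOf []       = refl , refl
    map-setsOf (t ∷ ts) = cong (_ ∷_) (proj₁ (map-setsOf ts)) , cong (_ ∷_) (proj₂ (map-setsOf ts))

    -- The palette is itself a list assignment, so the second clause is the first one with `Kᶜ` in
    -- place of `L`.
    compatible : ∀ t u → Compatible (setsOf t) (setsOf u)
    compatible t u =
      (λ p q → common-code K L t u p q , common-code K L u t q p) ,
      (λ p q → common-code K Kᶜ t u p q , common-code K Kᶜ u t q p)

    all-compatible : ∀ ts → AllPairs Compatible (map setsOf ts)
    all-compatible []       = []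
    all-compatible (t ∷ ts) =
      Allₚ.map⁺ (All.universal (compatible t) ts) ∷ all-compatible ts

  -- A class is a root colour together with a set of child classes. Root colours are matched by
  -- position in `K` and `L v`, child sets by `forest-injection`; `pair` lets both be read back from
  -- the image.
  fewer-codes : ∀ t → length (codes Kᶜ t) ≤ length (codes L t)
  forest-injection : ∀ ts → TransversalInjection (codesF Kᶜ ts) (codesF L ts)
  all-larger : ∀ ts → All Larger (map setsOf ts)
  all-larger []       = []
  all-larger (t ∷ ts) = (codes-unique L t , fewer-codes t) ∷ all-larger ts
  forest-injection ts = subst₂ TransversalInjection (proj₂ (map-setsOf ts)) (proj₁ (map-setsOf ts))
    (transversal-injection (map setsOf ts) (all-larger ts) (all-compatible ts))
  fewer-codes (node v ts) = length-≤-injective Match (codes-unique Kᶜ (node v ts)) total′ injective′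
    where
    open TransversalInjection (forest-injection ts)
    Match : ℕ → ℕ → Set
    Match y x = ∃[ b ] ∃[ zs ] ∃[ a ] ∃[ xs ] (y ≡ pair b (multisetCode zs) ×
      x ≡ pair a (multisetCode xs) × (b , a) ∈ zip K (L v) × Rel zs xs)
    total′ : ∀ {y} → y ∈ codes Kᶜ (node v ts) → ∃[ x ] (x ∈ codes L (node v ts) × Match y x)
    total′ y∈ with ∈-codes⁻ Kᶜ {v} ts y∈
    ... | b , zs , b∈ , tr , eq with ∈-zip (L-length v) b∈ | total tr
    ... | a , a∈ , ba∈ | xs , tr′ , r =
      _ , ∈-codes⁺ L a∈ tr′ , b , zs , a , xs , eq , refl , ba∈ , r
    injective′ : ∀ {y y′ x} → Match y x → Match y′ x → y ≡ y′
    injective′ (b , zs , a , xs , refl , refl , m , r) (b′ , zs′ , a′ , xs′ , refl , eq , m′ , r′)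
      with pair-injective a _ a′ _ eq
    ... | refl , eq′ = cong₂ pair (zip-injective K (L-unique v) m m′)
                         (multisetCode-cong (injective r r′ (multisetCode-injective eq′)))

  -- At the roots only totality of the injection matters; its injectivity serves the counts below.
  rigid-transfer : ∀ {ts us} → ZipF (Colouring Kᶜ) ts us → RigidF us →
    ∃[ us′ ] (ZipF (Colouring L) ts us′ × RigidF us′)
  rigid-transfer {ts} z (rs , uniq)
    with TransversalInjection.total (forest-injection ts) (rigid⇒transversal Kᶜ z rs , uniq)
  ... | xs , (pw , uniq′) , _ with transversal⇒rigid L ts pw
  ... | us′ , z′ , rs′ , refl = us′ , z′ , rs′ , uniq′

-- Positionwise relations, parent links and reorderings

ZipT-refl : ∀ {A} {S : A → A → Set} → (∀ {x} → S x x) → ∀ t → ZipT S t t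
ZipF-refl : ∀ {A} {S : A → A → Set} → (∀ {x} → S x x) → ∀ ts → ZipF S ts ts
ZipT-refl S-refl (node v ts) = node S-refl (ZipF-refl S-refl ts)
ZipF-refl S-refl []       = []
ZipF-refl S-refl (t ∷ ts) = ZipT-refl S-refl t ∷ ZipF-refl S-refl ts

ZipT-sym : ∀ {A} {S : A → A → Set} → (∀ {x y} → S x y → S y x) → ∀ {t u} → ZipT S t u → ZipT S u t
ZipF-sym : ∀ {A} {S : A → A → Set} → (∀ {x y} → S x y → S y x) → ∀ {ts us} → ZipF S ts us → ZipF S us ts
ZipT-sym S-sym (node s z) = node (S-sym s) (ZipF-sym S-sym z)
ZipF-sym S-sym []       = []
ZipF-sym S-sym (z ∷ zs) = ZipT-sym S-sym z ∷ ZipF-sym S-sym zs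

flatT-map : ∀ {A B} (f : A → B) t → flatT (mapT f t) ≡ map f (flatT t)
flatF-map : ∀ {A B} (f : A → B) ts → flatF (mapF f ts) ≡ map f (flatF ts)
flatT-map f (node v ts) = cong (f v ∷_) (flatF-map f ts)
flatF-map f []       = refl
flatF-map f (t ∷ ts) = trans (cong₂ _++_ (flatT-map f t) (flatF-map f ts)) (sym (map-++ f (flatT t) (flatF ts)))

-- Every vertex is listed together with its parent, a root having the given one.
linksT : ∀ {A} → Maybe A → Tree A → List (Maybe A × A)
linksF : ∀ {A} → Maybe A → Forest A → List (Maybe A × A)
linksT m (node v ts) = (m , v) ∷ linksF (just v) ts
linksF m []       = []
linksF m (t ∷ ts) = linksT m t ++ linksF m ts

links-flatT : ∀ {A} m (t : Tree A) → map proj₂ (linksT m t) ≡ flatT t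
links-flatF : ∀ {A} m (ts : Forest A) → map proj₂ (linksF m ts) ≡ flatF ts
links-flatT m (node v ts) = cong (v ∷_) (links-flatF (just v) ts)
links-flatF m []       = refl
links-flatF m (t ∷ ts) = trans (map-++ proj₂ (linksT m t) (linksF m ts))
  (cong₂ _++_ (links-flatT m t) (links-flatF m ts))

mapLink : ∀ {A B : Set} → (A → B) → Maybe A × A → Maybe B × B
mapLink f (m , v) = Maybe.map f m , f v

linksT-map : ∀ {A B} (f : A → B) m t → linksT (Maybe.map f m) (mapT f t) ≡ map (mapLink f) (linksT m t)
linksF-map : ∀ {A B} (f : A → B) m ts → linksF (Maybe.map f m) (mapF f ts) ≡ map (mapLink f) (linksF m ts)
linksT-map f m (node v ts) = cong (_ ∷_) (linksF-map f (just v) ts)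
linksF-map f m []       = refl
linksF-map f m (t ∷ ts) = trans (cong₂ _++_ (linksT-map f m t) (linksF-map f m ts))
  (sym (map-++ (mapLink f) (linksT m t) (linksF m ts)))

-- Equality up to hereditary reordering of siblings.
infix 4 _≈ᵀ_ _≈_

record _≈ᵀ_ {A : Set} (t u : Tree A) : Set where
  constructor mk≈
  field links : ∀ m → linksT m t ↭ linksT m u

record _≈_ {A : Set} (ts us : Forest A) : Set where
  constructor mk≈
  field links : ∀ m → linksF m ts ↭ linksF m us

open _≈ᵀ_
open _≈_

≈-refl : ∀ {A} {ts : Forest A} → ts ≈ ts
≈-refl = mk≈ λ m → ↭-refl

≈-sym : ∀ {A} {ts us : Forest A} → ts ≈ us → us ≈ ts
≈-sym p = mk≈ λ m → ↭-sym (links p m)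

≈-trans : ∀ {A} {ts us vs : Forest A} → ts ≈ us → us ≈ vs → ts ≈ vs
≈-trans p q = mk≈ λ m → ↭-trans (links p m) (links q m)

≈ᵀ-refl : ∀ {A} {t : Tree A} → t ≈ᵀ t
≈ᵀ-refl = mk≈ λ m → ↭-refl

-- The instance at `just v` is the reason why the relation quantifies over the parent of the roots.
≈-node : ∀ {A} {v : A} {ts us} → ts ≈ us → node v ts ≈ᵀ node v us
≈-node {v = v} p = mk≈ λ m → prep (m , v) (links p (just v))

≈-∷ : ∀ {A} {t u : Tree A} {ts us} → t ≈ᵀ u → ts ≈ us → t ∷ ts ≈ u ∷ us
≈-∷ p q = mk≈ λ m → ++⁺ (links p m) (links q m)

↭⇒≈ : ∀ {A} {ts us : Forest A} → ts ↭ us → ts ≈ us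
↭⇒≈ Perm.refl         = ≈-refl
↭⇒≈ (prep t p)   = ≈-∷ ≈ᵀ-refl (↭⇒≈ p)
↭⇒≈ (swap t u p) = mk≈ λ m → ↭-trans (shifts (linksT m t) (linksT m u))
  (++⁺ˡ (linksT m u) (++⁺ˡ (linksT m t) (links (↭⇒≈ p) m)))
↭⇒≈ (Perm.trans p q)  = ≈-trans (↭⇒≈ p) (↭⇒≈ q)

≈-flat : ∀ {A} {ts us : Forest A} → ts ≈ us → flatF ts ↭ flatF us
≈-flat {ts = ts} {us} p =
  subst₂ _↭_ (links-flatF nothing ts) (links-flatF nothing us) (map⁺ proj₂ (links p nothing))

-- Rigidity versus colour-preserving symmetries of forests

module _ {A : Set} (f : A → ℕ) where

  SameColour : A → A → Set
  SameColour x y = f x ≡ f y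

  colourCode : Tree A → ℕ
  colourCode t = code (mapT f t)

  codeF-mapF : ∀ ts → codeF (mapF f ts) ≡ map colourCode ts
  codeF-mapF []       = refl
  codeF-mapF (t ∷ ts) = cong (_ ∷_) (codeF-mapF ts)

  -- Equal codes become an actual isomorphism: equal multisets of child codes allow each child of
  -- `t` to be paired with a child of `u` of the same code, recursively.
  alignT : ∀ t u → colourCode t ≡ colourCode u →
    ∃[ u′ ] (u′ ≈ᵀ u × ZipT SameColour t u′)
  alignF : ∀ ts us → map colourCode ts ↭ map colourCode us →
    ∃[ us′ ] (us′ ≈ us × ZipF SameColour ts us′)
  alignT (node v ts) (node w us) eq with pair-injective (f v) _ (f w) _ eq
  ... | s , eq′ with alignF ts us (subst₂ _↭_ (codeF-mapF ts) (codeF-mapF us) (multisetCode-injective eq′))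
  ... | us′ , us′≈us , z = node w us′ , ≈-node us′≈us , node s z
  alignF []       []       α = [] , ≈-refl , []
  alignF []       (u ∷ us) α = contradiction (↭-sym α) ¬x∷xs↭[]
  alignF (t ∷ ts) us       α with ∈-map⁻ colourCode (∈-resp-↭ α (here refl))
  ... | u , u∈us , eq with ∈⇒↭∷ u∈us
  ... | us₁ , β with alignT t u eq | alignF ts us₁ (drop-∷ (↭-trans α
         (subst (λ c → map colourCode us ↭ c ∷ map colourCode us₁) (sym eq) (map⁺ colourCode β))))
  ... | u′ , p , z | us′ , q , zs =
    u′ ∷ us′ , ≈-trans (≈-∷ p q) (↭⇒≈ (↭-sym β)) , z ∷ zs

  -- A nontrivial colour-preserving automorphism given by two reorderings of one forest: it sends
  -- each vertex of `first` to the vertex of `second` in the same position. `differ` says that it is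
  -- not the identity.
  record Symmetry (ts : Forest A) : Set where
    field
      first second : Forest A
      first≈       : first ≈ ts
      second≈      : second ≈ ts
      zipped       : ZipF SameColour first second
      differ       : flatF first ≢ flatF second

  -- Failure of rigidity means two siblings with equal codes; after aligning one with the other they
  -- can be swapped, everything else staying in place.
  rigid-or-symmetric : ∀ ts → Unique (flatF ts) → RigidF (mapF f ts) ⊎ Symmetry ts
  rigid-or-symmetric [] _ = inj₁ ([] , [])
  rigid-or-symmetric (node v us ∷ ts) uniq@(_ ∷ uniq′)
    with Unique-++⁻ (flatF us) uniq′
  ... | uniq-us , uniq-ts , _ with rigid-or-symmetric us uniq-us | rigid-or-symmetric ts uniq-ts
  ... | inj₂ s | _ = inj₂ (record
    { first = node v first ∷ ts ; second = node v second ∷ ts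
    ; first≈ = ≈-∷ (≈-node first≈) ≈-refl
    ; second≈ = ≈-∷ (≈-node second≈) ≈-refl
    ; zipped = node refl zipped ∷ ZipF-refl refl ts
    ; differ = λ eq → differ (++-cancelʳ (flatF ts) _ _ (∷-injectiveʳ eq)) })
    where open Symmetry s
  ... | inj₁ _ | inj₂ s = inj₂ (record
    { first = node v us ∷ first ; second = node v us ∷ second
    ; first≈ = ≈-∷ ≈ᵀ-refl first≈
    ; second≈ = ≈-∷ ≈ᵀ-refl second≈
    ; zipped = ZipT-refl refl (node v us) ∷ zipped
    ; differ = λ eq → differ (++-cancelˡ (flatT (node v us)) _ _ eq) })
    where open Symmetry s
  ... | inj₁ (rs , uniq-codes) | inj₁ (rs′ , uniq-codes′)
    with colourCode (node v us) ∈? codeF (mapF f ts)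
  ... | no c∉ = inj₁ (node rs uniq-codes ∷ rs′ , Allₚ.¬Any⇒All¬ _ c∉ ∷ uniq-codes′)
  ... | yes c∈ with ∈-map⁻ colourCode (subst (_ ∈_) (codeF-mapF ts) c∈)
  ... | u , u∈ts , eq with ∈⇒↭∷ u∈ts | alignT (node v us) u eq
  ... | rest , α | u′@(node w us′) , p , z = inj₂ (record
    { first = node v us ∷ u′ ∷ rest ; second = u′ ∷ node v us ∷ rest
    ; first≈ = first≈′
    ; second≈ = ≈-trans (↭⇒≈ (swap u′ (node v us) ↭-refl)) first≈′
    ; zipped = z ∷ ZipT-sym sym z ∷ ZipF-refl refl rest
    ; differ = differ′ })
    where
    first≈′ : node v us ∷ u′ ∷ rest ≈ node v us ∷ ts
    first≈′ = ≈-∷ ≈ᵀ-refl (≈-trans (≈-∷ p ≈-refl) (↭⇒≈ (↭-sym α)))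
    -- The two flat lists start with the roots of the swapped siblings, which are distinct vertices.
    differ′ : flatF (node v us ∷ u′ ∷ rest) ≢ flatF (u′ ∷ node v us ∷ rest)
    differ′ eq′ with Unique-resp-↭ (↭-sym (≈-flat first≈′)) uniq
    ... | v∉ ∷ _ = All.lookup v∉ (∈-++⁺ʳ (flatF us) (here refl)) (proj₁ (∷-injective eq′))

-- Forests presenting a graph

map≡id⇒fixed : ∀ {A : Set} {g : A → A} xs → map g xs ≡ xs → ∀ {x} → x ∈ xs → g x ≡ x
map≡id⇒fixed (x ∷ xs) eq (here refl) = proj₁ (∷-injective eq)
map≡id⇒fixed (x ∷ xs) eq (there x∈)  = map≡id⇒fixed xs (proj₂ (∷-injective eq)) x∈

-- Distinct roots count as neighbours: this covers a tree rooted at an edge.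
Neighbours : ∀ {A} → Forest A → A → A → Set
Neighbours F x y = (just x , y) ∈ linksF nothing F ⊎ (just y , x) ∈ linksF nothing F ⊎
  (x ≢ y × (nothing , x) ∈ linksF nothing F × (nothing , y) ∈ linksF nothing F)

Neighbours-map : ∀ {A B} (σ : A → B) F {x y} → (σ x ≡ σ y → x ≡ y) →
  Neighbours F x y → Neighbours (mapF σ F) (σ x) (σ y)
Neighbours-map σ F inj nb = go nb
  where
  image : ∀ {l} → l ∈ linksF nothing F → mapLink σ l ∈ linksF nothing (mapF σ F)
  image l∈ = subst (_ ∈_) (sym (linksF-map σ nothing F)) (∈-map⁺ (mapLink σ) l∈)
  go : Neighbours F _ _ → Neighbours (mapF σ F) (σ _) (σ _)
  go (inj₁ l) = inj₁ (image l)
  go (inj₂ (inj₁ l)) = inj₂ (inj₁ (image l))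
  go (inj₂ (inj₂ (x≢y , l , l′))) = inj₂ (inj₂ (x≢y ∘ inj , image l , image l′))

Neighbours-resp-≈ : ∀ {A} {F F′ : Forest A} → F ≈ F′ → ∀ {x y} → Neighbours F x y → Neighbours F′ x y
Neighbours-resp-≈ p (inj₁ l) = inj₁ (∈-resp-↭ (links p nothing) l)
Neighbours-resp-≈ p (inj₂ (inj₁ l)) = inj₂ (inj₁ (∈-resp-↭ (links p nothing) l))
Neighbours-resp-≈ p (inj₂ (inj₂ (x≢y , l , l′))) =
  inj₂ (inj₂ (x≢y , ∈-resp-↭ (links p nothing) l , ∈-resp-↭ (links p nothing) l′))

≡-from-⇔ : ∀ {a b : Bool} → (a ≡ true → b ≡ true) → (b ≡ true → a ≡ true) → a ≡ b
≡-from-⇔ {true}  {b}     f g = sym (f refl)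
≡-from-⇔ {false} {true}  f g = g refl
≡-from-⇔ {false} {false} f g = refl

record Presents {n} (F : Forest (Fin n)) (G : Graph n) : Set where
  field
    unique    : Unique (flatF F)
    complete  : ∀ x → x ∈ flatF F
    adjacent⁺ : ∀ {x y} → Adj G x y → Neighbours F x y
    adjacent⁻ : ∀ {x y} → Neighbours F x y → Adj G x y

module _ {n} {G : Graph n} {F : Forest (Fin n)} (presents : Presents F G) where
  open Presents presents

  -- A `Symmetry` yields an automorphism: adjacency is read off the parent links, which reordering
  -- siblings leaves unchanged. As f is distinguishing it is the identity, contradicting `differ`.
  distinguishing⇒rigid : ∀ {f} → Distinguishing G f → RigidF (mapF f F)
  distinguishing⇒rigid {f} dist with rigid-or-symmetric f F unique
  ... | inj₁ r = r
  ... | inj₂ s = contradiction same differ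
    where
    open Symmetry s

    complete′ : ∀ {F′} → F′ ≈ F → ∀ x → x ∈ flatF F′
    complete′ p x = ∈-resp-↭ (↭-sym (≈-flat p)) (complete x)

    map-between : ∀ {F₁ F₂} → F₁ ≈ F → ZipF (SameColour f) F₁ F₂ →
      ∃[ σ ] (mapF σ F₁ ≡ F₂ × (∀ {v} → v ∈ flatF F₁ → f v ≡ f (σ v)))
    map-between {F₁} {[]} p [] = id , refl , λ ()
    map-between {F₁} {node v _ ∷ _} p z =
      -- `Fin n` might be empty, so the default vertex is taken from the forest itself.
      relabelF _≟ᶠ_ v (Unique-resp-↭ (↭-sym (≈-flat p)) unique) z

    σ-spec = map-between first≈ zipped
    τ-spec = map-between second≈ (ZipF-sym sym zipped)
    σ = proj₁ σ-spec
    τ = proj₁ τ-spec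

    inverse : ∀ {F₁ F₂} (g h : Fin n → Fin n) → F₁ ≈ F → mapF g F₁ ≡ F₂ → mapF h F₂ ≡ F₁ →
      ∀ x → h (g x) ≡ x
    inverse {F₁} g h p refl eq x = map≡id⇒fixed (flatF F₁) lemma (complete′ p x)
      where
      lemma : map (h ∘ g) (flatF F₁) ≡ flatF F₁
      lemma = begin
        map (h ∘ g) (flatF F₁)        ≡⟨ map-∘ (flatF F₁) ⟩
        map h (map g (flatF F₁))      ≡⟨ cong (map h) (flatF-map g F₁) ⟨
        map h (flatF (mapF g F₁))     ≡⟨ flatF-map h (mapF g F₁) ⟨
        flatF (mapF h (mapF g F₁))    ≡⟨ cong flatF eq ⟩
        flatF F₁                      ∎
        where open ≡-Reasoning

    τσ : ∀ x → τ (σ x) ≡ x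
    τσ = inverse σ τ first≈ (proj₁ (proj₂ σ-spec)) (proj₁ (proj₂ τ-spec))

    στ : ∀ x → σ (τ x) ≡ x
    στ = inverse τ σ second≈ (proj₁ (proj₂ τ-spec)) (proj₁ (proj₂ σ-spec))

    preserve : ∀ {F₁ F₂} (g h : Fin n → Fin n) → F₁ ≈ F → F₂ ≈ F → mapF g F₁ ≡ F₂ →
      (∀ x → h (g x) ≡ x) → ∀ {x y} → Adj G x y → Adj G (g x) (g y)
    preserve {F₁} {F₂} g h p q refl hg {x} {y} xy = adjacent⁻ (Neighbours-resp-≈ q
      (Neighbours-map g F₁ (λ eq → trans (sym (hg x)) (trans (cong h eq) (hg y)))
        (Neighbours-resp-≈ (≈-sym p) (adjacent⁺ xy))))

    automorphism : Automorphism G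
    automorphism = record
      { to = σ ; from = τ ; to-from = στ ; from-to = τσ
      ; pres = λ u v → ≡-from-⇔
          (λ e → subst₂ (Adj G) (τσ u) (τσ v)
            (preserve τ σ second≈ first≈ (proj₁ (proj₂ τ-spec)) στ e))
          (preserve σ τ first≈ second≈ (proj₁ (proj₂ σ-spec)) τσ) }

    same : flatF first ≡ flatF second
    same = trans (sym (trans (flatF-map σ first) (map-id-local (All.tabulate λ {x} _ →
        dist automorphism (λ v → sym (proj₂ (proj₂ σ-spec) (complete′ first≈ v))) x))))
      (cong flatF (proj₁ (proj₂ σ-spec)))

-- Membership in flattened forests

∈-++[]⁻ : ∀ {A : Set} {x : A} {xs} → x ∈ xs ++ [] → x ∈ xs
∈-++[]⁻ {x = x} {xs} = subst (x ∈_) (++-identityʳ xs)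

∈-flatF-map⁺ : ∀ {A B : Set} (g : A → Tree B) {ws w x} → w ∈ ws → x ∈ flatT (g w) → x ∈ flatF (map g ws)
∈-flatF-map⁺ g (here refl) x∈ = ∈-++⁺ˡ x∈
∈-flatF-map⁺ g {w′ ∷ _} (there w∈) x∈ = ∈-++⁺ʳ (flatT (g w′)) (∈-flatF-map⁺ g w∈ x∈)

∈-flatF-map⁻ : ∀ {A B : Set} (g : A → Tree B) ws {x} → x ∈ flatF (map g ws) → ∃[ w ] (w ∈ ws × x ∈ flatT (g w))
∈-flatF-map⁻ g (w ∷ ws) x∈ with ∈-++⁻ (flatT (g w)) x∈
... | inj₁ x∈w = w , here refl , x∈w
... | inj₂ x∈ws with ∈-flatF-map⁻ g ws x∈ws
... | w′ , w′∈ , x∈w′ = w′ , there w′∈ , x∈w′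

∈-linksF-map⁺ : ∀ {A B : Set} (g : A → Tree B) {m ws w l} → w ∈ ws → l ∈ linksT m (g w) → l ∈ linksF m (map g ws)
∈-linksF-map⁺ g (here refl) l∈ = ∈-++⁺ˡ l∈
∈-linksF-map⁺ g {m} {w′ ∷ _} (there w∈) l∈ = ∈-++⁺ʳ (linksT m (g w′)) (∈-linksF-map⁺ g w∈ l∈)

∈-linksF-map⁻ : ∀ {A B : Set} (g : A → Tree B) {m} ws {l} → l ∈ linksF m (map g ws) →
  ∃[ w ] (w ∈ ws × l ∈ linksT m (g w))
∈-linksF-map⁻ g {m} (w ∷ ws) l∈ with ∈-++⁻ (linksT m (g w)) l∈
... | inj₁ l∈w = w , here refl , l∈w
... | inj₂ l∈ws with ∈-linksF-map⁻ g ws l∈ws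
... | w′ , w′∈ , l∈w′ = w′ , there w′∈ , l∈w′

flatF-map-unique : ∀ {A B : Set} (g : A → Tree B) ws → Unique ws → (∀ {w} → w ∈ ws → Unique (flatT (g w))) →
  (∀ {w w′ x} → w ∈ ws → w′ ∈ ws → x ∈ flatT (g w) → x ∈ flatT (g w′) → w ≡ w′) →
  Unique (flatF (map g ws))
flatF-map-unique g []       _          uniq disj = []
flatF-map-unique g (w ∷ ws) (w∉ ∷ uws) uniq disj = Uniqueₚ.++⁺ (uniq (here refl))
  (flatF-map-unique g ws uws (uniq ∘ there) (λ p q → disj (there p) (there q)))
  λ { (x∈w , x∈ws) → let w′ , w′∈ , x∈w′ = ∈-flatF-map⁻ g ws x∈ws in
      All.lookup w∉ w′∈ (disj (here refl) (there w′∈) x∈w x∈w′) }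

Unique-map-injective : ∀ {A B : Set} (g : A → B) {xs} → Unique (map g xs) →
  ∀ {x y} → x ∈ xs → y ∈ xs → g x ≡ g y → x ≡ y
Unique-map-injective g (_ ∷ _) (here refl) (here refl) eq = refl
Unique-map-injective g (p ∷ _) (here refl) (there y∈)  eq = contradiction eq (All.lookup p (∈-map⁺ g y∈))
Unique-map-injective g (p ∷ _) (there x∈)  (here refl) eq = contradiction (sym eq) (All.lookup p (∈-map⁺ g x∈))
Unique-map-injective g (_ ∷ u) (there x∈)  (there y∈)  eq = Unique-map-injective g u x∈ y∈ eq

All-mapF⁻ : ∀ {A} {P : Tree ℕ → Set} (f : A → ℕ) {ts t} → All P (mapF f ts) → t ∈ ts → P (mapT f t)
All-mapF⁻ f (p ∷ ps) (here refl) = p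
All-mapF⁻ f (p ∷ ps) (there t∈)  = All-mapF⁻ f ps t∈

prefix-linked : ∀ {A : Set} {R : A → A → Set} a as {w bs} → Linked R (a ∷ as ++ w ∷ bs) →
  Linked R (a ∷ as) × ∃[ b ] (last (a ∷ as) ≡ just b × R b w)
prefix-linked a []        (r ∷ _) = [-] , a , refl , r
prefix-linked a (a′ ∷ as) (r ∷ l) with prefix-linked a′ as l
... | l′ , b , eq , rbw = r ∷ l′ , b , eq , rbw

-- Non-backtracking walks and branches

module Darts {n} (G : Graph n) where

  V : Set
  V = Fin n

  Adj-sym : ∀ {u v} → Adj G u v → Adj G v u
  Adj-sym {u} {v} uv = trans (symm G v u) uv

  Adj-irrefl : ∀ {u v} → Adj G u v → u ≢ v
  Adj-irrefl {u} uv refl with trans (sym uv) (irrefl G u)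
  ... | ()

  -- For p = v these are all the neighbours of v.
  children : V → V → List V
  children p v = filter (λ w → (adj G v w Bool.≟ true) ×-dec ¬? (w ≟ᶠ p)) (allFin n)

  ∈-children⁺ : ∀ {p v w} → Adj G v w → w ≢ p → w ∈ children p v
  ∈-children⁺ {w = w} vw w≢p = ∈-filter⁺ _ (∈-allFin w) (vw , w≢p)

  ∈-children⁻ : ∀ {p v w} → w ∈ children p v → Adj G v w × w ≢ p
  ∈-children⁻ w∈ = proj₂ (∈-filter⁻ _ {xs = allFin n} w∈)

  children-unique : ∀ p v → Unique (children p v)
  children-unique p v = Uniqueₚ.filter⁺ _ (Uniqueₚ.allFin⁺ n)

  -- A non-backtracking walk, latest vertex first. Unlike `Reach` it keeps its whole history, so
  -- that a new vertex can be compared with all earlier ones.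
  data Trail : List V → Set where
    edge : ∀ {p v} → Adj G p v → Trail (v ∷ p ∷ [])
    _▷_  : ∀ {p v w xs} → Trail (v ∷ p ∷ xs) → w ∈ children p v → Trail (w ∷ v ∷ p ∷ xs)

  trail-linked : ∀ {xs} → Trail xs → Linked (Adj G) xs
  trail-linked (edge pv) = Adj-sym pv ∷ [-]
  trail-linked (t ▷ w∈)  = Adj-sym (proj₁ (∈-children⁻ w∈)) ∷ trail-linked t

  -- Reach p v q x: a non-backtracking walk starts with the step p → v and ends with q → x.
  data Reach (p v : V) : V → V → Set where
    start : Reach p v p v
    _▷_   : ∀ {q x y} → Reach p v q x → y ∈ children q x → Reach p v x y

  reach-trans : ∀ {p v q x r y} → Reach p v q x → Reach q x r y → Reach p v r y
  reach-trans s start    = s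
  reach-trans s (t ▷ y∈) = reach-trans s t ▷ y∈

  reach-cons : ∀ {p v w q x} → w ∈ children p v → Reach v w q x → Reach p v q x
  reach-cons w∈ = reach-trans (start ▷ w∈)

  reach-uncons : ∀ {p v q x} → Reach p v q x →
    (p ≡ q × v ≡ x) ⊎ (∃[ w ] (w ∈ children p v × Reach v w q x))
  reach-uncons start = inj₁ (refl , refl)
  reach-uncons (r ▷ y∈) with reach-uncons r
  ... | inj₁ (refl , refl)   = inj₂ (_ , y∈ , start)
  ... | inj₂ (w , w∈ , r′) = inj₂ (w , w∈ , r′ ▷ y∈)

  reach-adj : ∀ {p v q x} → Adj G p v → Reach p v q x → Adj G q x
  reach-adj pv start    = pv
  reach-adj pv (r ▷ y∈) = proj₁ (∈-children⁻ y∈)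

  reach-reverse : ∀ {p v q x} → Adj G p v → Reach p v q x → Reach x q v p
  reach-reverse pv start    = start
  reach-reverse pv (r ▷ y∈) = reach-cons
    (∈-children⁺ (Adj-sym (reach-adj pv r)) (λ q≡y → proj₂ (∈-children⁻ y∈) (sym q≡y)))
    (reach-reverse pv r)

  unfold : ℕ → V → V → Tree V
  unfold zero    p v = node v []
  unfold (suc m) p v = node v (map (unfold m v) (children p v))

  -- The component of v after deleting the edge p v (the whole tree if p = v), rooted at v;
  -- the depth suc n suffices in an acyclic graph.
  branch : V → V → Tree V
  branch = unfold (suc n)

  size : V → V → ℕ
  size p v = length (flatT (branch p v))

-- Branches of acyclic graphs

module AcyclicGraph {n} (G : Graph n) (acyclic : Acyclic G) where
  open Darts G public

  -- At a first repetition w, the trail since the earlier visit to w closes up to a cycle. Its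
  -- length is at least 3: w differs from v as there are no loops, and from p as the trail does not
  -- backtrack.
  trail-unique : ∀ {xs} → Trail xs → Unique xs
  trail-unique (edge pv) = ((λ eq → Adj-irrefl pv (sym eq)) ∷ []) ∷ [] ∷ []
  trail-unique {w ∷ v ∷ p ∷ xs} (t ▷ w∈) = Allₚ.¬Any⇒All¬ (v ∷ p ∷ xs) w∉ ∷ trail-unique t
    where
    vw = proj₁ (∈-children⁻ w∈)
    w∉ : w ∉ v ∷ p ∷ xs
    w∉ (here w≡v)            = Adj-irrefl vw (sym w≡v)
    w∉ (there (here w≡p))    = proj₂ (∈-children⁻ w∈) w≡p
    w∉ (there (there w∈xs)) with ∈-∃++ w∈xs
    ... | as , bs , refl with Unique-++⁻ (v ∷ p ∷ as) (trail-unique t)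
                            | prefix-linked v (p ∷ as) (trail-linked t)
    ... | uniq , _ , disj | linked , b , last≡b , bw = acyclic (w ∷ v ∷ p ∷ as)
      ( s≤s (s≤s (s≤s z≤n))
      , Allₚ.¬Any⇒All¬ (v ∷ p ∷ as) (λ w∈as → disj w∈as (here refl)) ∷ uniq
      , Adj-sym vw ∷ linked
      , w , b , refl , last≡b , bw)

  no-return : ∀ {p v q x} → Adj G p v → Reach p v q x → x ≢ p
  no-return {p} {v} pv r with toTrail r
    where
    toTrail : ∀ {q x} → Reach p v q x → ∃[ xs ] (Trail (x ∷ q ∷ xs) × p ∈ q ∷ xs)
    toTrail start = [] , edge pv , here refl
    toTrail (r ▷ y∈) with toTrail r
    ... | xs , t , p∈ = _ , t ▷ y∈ , there p∈
  ... | xs , t , p∈ with trail-unique t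
  ... | x∉ ∷ _ = All.lookup x∉ p∈

  -- At most m - 1 further non-backtracking steps are possible after p, v.
  Bounded : ℕ → V → V → Set
  Bounded zero    p v = ⊥
  Bounded (suc m) p v = ∀ {w} → w ∈ children p v → Bounded m v w

  trail-bounded : ∀ m {p v xs} → Trail (v ∷ p ∷ xs) → n < length (v ∷ p ∷ xs) + m → Bounded m p v
  trail-bounded zero {p} {v} {xs} t n< = contradiction
    (subst (n <_) (+-identityʳ _) n<)
    (≤⇒≯ (≤-trans (length-≤-⊆ (trail-unique t) (λ {x} _ → ∈-allFin x)) (≤-reflexive (length-tabulate id))))
  trail-bounded (suc m) {p} {v} {xs} t n< w∈ =
    trail-bounded m (t ▷ w∈) (subst (n <_) (+-suc (length (v ∷ p ∷ xs)) m) n<)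

  bounded : ∀ p v → Bounded (suc n) p v
  -- The pair p, v need not be an edge (p = v at a vertex root), so the trail starts with the edge
  -- from v to its child; this costs the extra step in `suc n`.
  bounded p v w∈ = trail-bounded n (edge (proj₁ (∈-children⁻ w∈))) (s≤s (n≤1+n n))

  -- Replaces recursion on the depth argument of `unfold`: acyclicity makes passing to children
  -- well-founded.
  dart-induction : (P : V → V → Set) →
    (∀ p v → (∀ {w} → w ∈ children p v → P v w) → P p v) → ∀ p v → P p v
  dart-induction P step p v = go (suc n) p v (bounded p v)
    where
    go : ∀ m p v → Bounded m p v → P p v
    go (suc m) p v b = step p v (λ w∈ → go m v _ (b w∈))

  -- Depth `suc n` already exhausts every branch, so one more level changes nothing.
  branch-unfold : ∀ p v → branch p v ≡ node v (map (branch v) (children p v))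
  branch-unfold p v = stable (suc n) p v (bounded p v)
    where
    stable : ∀ m p v → Bounded m p v → unfold m p v ≡ unfold (suc m) p v
    stable (suc m) p v b =
      cong (node v) (map-cong-local (All.tabulate λ w∈ → stable m v _ (b w∈)))

  reach⇒∈ : ∀ p v {q x} → Reach p v q x → x ∈ flatT (branch p v)
  reach⇒∈ = dart-induction (λ p v → ∀ {q x} → Reach p v q x → x ∈ flatT (branch p v)) step
    where
    step : ∀ p v → (∀ {w} → w ∈ children p v → ∀ {q x} → Reach v w q x → x ∈ flatT (branch v w)) →
      ∀ {q x} → Reach p v q x → x ∈ flatT (branch p v)
    step p v ih {x = x} r with reach-uncons r
    ... | inj₁ (_ , refl) = here refl
    ... | inj₂ (w , w∈ , r′) =
      subst (λ t → x ∈ flatT t) (sym (branch-unfold p v)) (there (∈-flatF-map⁺ (branch v) w∈ (ih w∈ r′)))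

  ∈⇒reach : ∀ p v {x} → x ∈ flatT (branch p v) → ∃[ q ] Reach p v q x
  ∈⇒reach = dart-induction (λ p v → ∀ {x} → x ∈ flatT (branch p v) → ∃[ q ] Reach p v q x) step
    where
    step : ∀ p v → (∀ {w} → w ∈ children p v → ∀ {x} → x ∈ flatT (branch v w) → ∃[ q ] Reach v w q x) →
      ∀ {x} → x ∈ flatT (branch p v) → ∃[ q ] Reach p v q x
    step p v ih {x} x∈ with subst (λ t → x ∈ flatT t) (branch-unfold p v) x∈
    ... | here refl = p , start
    ... | there x∈F with ∈-flatF-map⁻ (branch v) (children p v) x∈F
    ... | w , w∈ , x∈w with ih w∈ x∈w
    ... | q , r = q , reach-cons w∈ r

  -- Reversing the walk from the edge to x on one side and continuing with the walk to x on the
  -- other side would be a non-backtracking return to x.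
  branch-disjoint : ∀ {a b x} → Adj G a b → x ∈ flatT (branch a b) → x ∉ flatT (branch b a)
  branch-disjoint {a} {b} ab x∈ x∈′ with ∈⇒reach a b x∈ | ∈⇒reach b a x∈′
  ... | q , r | q′ , r′ =
    no-return (Adj-sym (reach-adj ab r)) (reach-trans (reach-reverse ab r) r′) refl

  -- For distinct w and w′, the branch at w′ lies on the v side of the edge between v and w.
  siblings-disjoint : ∀ {v w w′ x} → Adj G v w → Adj G v w′ →
    x ∈ flatT (branch v w) → x ∈ flatT (branch v w′) → w ≡ w′
  siblings-disjoint {v} {w} {w′} vw vw′ x∈ x∈′ with w ≟ᶠ w′
  ... | yes w≡w′ = w≡w′
  ... | no w≢w′ with ∈⇒reach v w′ x∈′
  ... | q′ , r′ = contradiction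
    (reach⇒∈ w v (reach-cons (∈-children⁺ vw′ (λ eq → w≢w′ (sym eq))) r′))
    (branch-disjoint vw x∈)

  branch-unique : ∀ p v → Unique (flatT (branch p v))
  branch-unique = dart-induction (λ p v → Unique (flatT (branch p v))) λ p v ih →
    subst (Unique ∘ flatT) (sym (branch-unfold p v))
      (Allₚ.¬Any⇒All¬ _ (v∉ p v) ∷ flatF-map-unique (branch v) (children p v) (children-unique p v) ih
        (λ w∈ w′∈ → siblings-disjoint (proj₁ (∈-children⁻ w∈)) (proj₁ (∈-children⁻ w′∈))))
    where
    v∉ : ∀ p v → v ∉ flatF (map (branch v) (children p v))
    v∉ p v v∈ with ∈-flatF-map⁻ (branch v) (children p v) v∈
    ... | w , w∈ , v∈w with ∈⇒reach v w v∈w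
    ... | q , r = no-return (proj₁ (∈-children⁻ w∈)) r refl

  reach⇒link : ∀ p v {q x y m} → Reach p v q x → y ∈ children q x → (just x , y) ∈ linksT m (branch p v)
  reach⇒link = dart-induction
    (λ p v → ∀ {q x y m} → Reach p v q x → y ∈ children q x → (just x , y) ∈ linksT m (branch p v)) step
    where
    step : ∀ p v → (∀ {w} → w ∈ children p v → ∀ {q x y m} → Reach v w q x → y ∈ children q x →
                     (just x , y) ∈ linksT m (branch v w)) →
      ∀ {q x y m} → Reach p v q x → y ∈ children q x → (just x , y) ∈ linksT m (branch p v)
    step p v ih {x = x} {y} {m} r y∈ = subst (λ t → (just x , y) ∈ linksT m t) (sym (branch-unfold p v)) (there (inside (reach-uncons r)))
      where
      inside : (p ≡ _ × v ≡ _) ⊎ (∃[ w ] (w ∈ children p v × Reach v w _ _)) →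
        (just _ , _) ∈ linksF (just v) (map (branch v) (children p v))
      inside (inj₁ (refl , refl))  = ∈-linksF-map⁺ (branch v) y∈ (here refl)
      inside (inj₂ (w , w∈ , r′)) = ∈-linksF-map⁺ (branch v) w∈ (ih w∈ r′ y∈)

  link⇒adj : ∀ p v {m m′ x} → (m′ , x) ∈ linksT m (branch p v) →
    (m′ ≡ m × x ≡ v) ⊎ (∃[ q ] (m′ ≡ just q × Adj G q x))
  link⇒adj = dart-induction (λ p v → ∀ {m m′ x} → (m′ , x) ∈ linksT m (branch p v) →
    (m′ ≡ m × x ≡ v) ⊎ (∃[ q ] (m′ ≡ just q × Adj G q x))) step
    where
    step : ∀ p v → (∀ {w} → w ∈ children p v → ∀ {m m′ x} → (m′ , x) ∈ linksT m (branch v w) →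
                     (m′ ≡ m × x ≡ w) ⊎ (∃[ q ] (m′ ≡ just q × Adj G q x))) →
      ∀ {m m′ x} → (m′ , x) ∈ linksT m (branch p v) →
      (m′ ≡ m × x ≡ v) ⊎ (∃[ q ] (m′ ≡ just q × Adj G q x))
    step p v ih {m} {m′} {x} l∈ with subst (λ t → (m′ , x) ∈ linksT m t) (branch-unfold p v) l∈
    ... | here refl = inj₁ (refl , refl)
    ... | there l∈F with ∈-linksF-map⁻ (branch v) (children p v) l∈F
    ... | w , w∈ , l∈w with ih w∈ l∈w
    ... | inj₁ (refl , refl) = inj₂ (v , refl , proj₁ (∈-children⁻ w∈))
    ... | inj₂ other = inj₂ other

  -- Moving to y either extends the walk or undoes its last step; only undoing the initial step can
  -- leave the branch.
  adj⇒reach : ∀ {p v q x y} → Reach p v q x → Adj G x y → (∃[ r ] Reach p v r y) ⊎ (x ≡ v × y ≡ p)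
  adj⇒reach {q = q} {y = y} r xy with y ≟ᶠ q
  ... | no y≢q = inj₁ (_ , r ▷ ∈-children⁺ xy y≢q)
  adj⇒reach start    xy | yes refl = inj₂ (refl , refl)
  adj⇒reach (r ▷ _) xy | yes refl = inj₁ (_ , r)

  adj⇒link : ∀ {p v q x y m} → Reach p v q x → Adj G x y →
    (just x , y) ∈ linksT m (branch p v) ⊎ (just y , x) ∈ linksT m (branch p v) ⊎ (x ≡ v × y ≡ p)
  adj⇒link {p} {v} {q} {y = y} r xy with y ≟ᶠ q
  ... | no y≢q = inj₁ (reach⇒link p v r (∈-children⁺ xy y≢q))
  adj⇒link start    xy | yes refl = inj₂ (inj₂ (refl , refl))
  adj⇒link {p} {v} (r ▷ x∈) xy | yes refl = inj₂ (inj₁ (reach⇒link p v r x∈))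

  size-child : ∀ {p v w} → w ∈ children p v → size v w < size p v
  size-child {p} {v} {w} w∈ = length-≤-⊆ {xs = v ∷ flatT (branch v w)}
    (Allₚ.¬Any⇒All¬ _ (λ v∈ → no-return (proj₁ (∈-children⁻ w∈)) (proj₂ (∈⇒reach v w v∈)) refl) ∷ branch-unique v w)
    λ { (here refl) → here refl
      ; (there x∈) → reach⇒∈ p v (reach-cons w∈ (proj₂ (∈⇒reach v w x∈))) }

  size-reach : ∀ {p v q x} → Reach p v q x → (p ≡ q × v ≡ x) ⊎ size q x < size p v
  size-reach start = inj₁ (refl , refl)
  size-reach (r ▷ y∈) with size-reach r
  ... | inj₁ (refl , refl) = inj₂ (size-child y∈)
  ... | inj₂ lt            = inj₂ (<-trans (size-child y∈) lt)

-- Trees rooted at a vertex or at an edge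

module TreeGraph {n} (G : Graph n) (connected : Connected G) (acyclic : Acyclic G) where
  open AcyclicGraph G acyclic public

  walk-invariant : (P : V → Set) → (∀ {u w} → P u → Adj G u w → P w) → ∀ {u v} → Walk G u v → P u → P v
  walk-invariant P step Walk.here         pu = pu
  walk-invariant P step (Walk.step uw wk) pu = walk-invariant P step wk (step pu uw)

  reach-from-vertex : ∀ c x → ∃[ q ] Reach c c q x
  reach-from-vertex c x = walk-invariant (λ x → ∃[ q ] Reach c c q x) step (connected c x) (c , start)
    where
    step : ∀ {u w} → ∃[ q ] Reach c c q u → Adj G u w → ∃[ q ] Reach c c q w
    step (q , r) uw with adj⇒reach r uw
    ... | inj₁ s             = s
    ... | inj₂ (refl , refl) = c , start

  reach-from-edge : ∀ a b x → (∃[ q ] Reach a b q x) ⊎ (∃[ q ] Reach b a q x)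
  reach-from-edge a b x =
    walk-invariant (λ x → (∃[ q ] Reach a b q x) ⊎ (∃[ q ] Reach b a q x)) step (connected a x)
      (inj₂ (b , start))
    where
    step : ∀ {u w} → (∃[ q ] Reach a b q u) ⊎ (∃[ q ] Reach b a q u) → Adj G u w →
      (∃[ q ] Reach a b q w) ⊎ (∃[ q ] Reach b a q w)
    step (inj₁ (q , r)) uw with adj⇒reach r uw
    ... | inj₁ s             = inj₁ s
    ... | inj₂ (refl , refl) = inj₂ (b , start)
    step (inj₂ (q , r)) uw with adj⇒reach r uw
    ... | inj₁ s             = inj₂ s
    ... | inj₂ (refl , refl) = inj₁ (a , start)

  vertexForest : V → Forest V
  vertexForest c = branch c c ∷ []

  edgeForest : V → V → Forest V
  edgeForest a b = branch a b ∷ branch b a ∷ []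

  vertexForest-presents : ∀ c → Presents (vertexForest c) G
  vertexForest-presents c = record
    { unique = subst Unique (sym (++-identityʳ _)) (branch-unique c c)
    ; complete = λ x → ∈-++⁺ˡ (reach⇒∈ c c (proj₂ (reach-from-vertex c x)))
    ; adjacent⁺ = adjacent⁺
    ; adjacent⁻ = adjacent⁻ }
    where
    only : ∀ {l} → l ∈ linksT nothing (branch c c) ++ [] → l ∈ linksT nothing (branch c c)
    only = ∈-++[]⁻
    adjacent⁺ : ∀ {x y} → Adj G x y → Neighbours (vertexForest c) x y
    adjacent⁺ {x} xy with adj⇒link {m = nothing} (proj₂ (reach-from-vertex c x)) xy
    ... | inj₁ l                   = inj₁ (∈-++⁺ˡ l)
    ... | inj₂ (inj₁ l)            = inj₂ (inj₁ (∈-++⁺ˡ l))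
    ... | inj₂ (inj₂ (refl , refl)) = contradiction refl (Adj-irrefl xy)
    link : ∀ {x y} → (just x , y) ∈ linksF nothing (vertexForest c) → Adj G x y
    link l with link⇒adj c c (only l)
    ... | inj₂ (_ , refl , xy) = xy
    is-root : ∀ {x} → (nothing , x) ∈ linksF nothing (vertexForest c) → x ≡ c
    is-root l with link⇒adj c c (only l)
    ... | inj₁ (_ , eq) = eq
    adjacent⁻ : ∀ {x y} → Neighbours (vertexForest c) x y → Adj G x y
    adjacent⁻ (inj₁ l)        = link l
    adjacent⁻ (inj₂ (inj₁ l)) = Adj-sym (link l)
    adjacent⁻ (inj₂ (inj₂ (x≢y , l , l′))) = contradiction (trans (is-root l) (sym (is-root l′))) x≢y

  edgeForest-presents : ∀ {a b} → Adj G a b → Presents (edgeForest a b) G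
  edgeForest-presents {a} {b} ab = record
    { unique = Uniqueₚ.++⁺ (branch-unique a b) (subst Unique (sym (++-identityʳ _)) (branch-unique b a))
        (λ { (x∈ , x∈′) → branch-disjoint ab x∈ (∈-++[]⁻ x∈′) })
    ; complete = complete
    ; adjacent⁺ = adjacent⁺
    ; adjacent⁻ = adjacent⁻ }
    where
    F = edgeForest a b
    complete : ∀ x → x ∈ flatF F
    complete x with reach-from-edge a b x
    ... | inj₁ (_ , r) = ∈-++⁺ˡ (reach⇒∈ a b r)
    ... | inj₂ (_ , r) = ∈-++⁺ʳ (flatT (branch a b)) (∈-++⁺ˡ (reach⇒∈ b a r))
    left : ∀ {l} → l ∈ linksT nothing (branch a b) → l ∈ linksF nothing F
    left = ∈-++⁺ˡ
    right : ∀ {l} → l ∈ linksT nothing (branch b a) → l ∈ linksF nothing F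
    right l = ∈-++⁺ʳ (linksT nothing (branch a b)) (∈-++⁺ˡ l)
    adjacent⁺ : ∀ {x y} → Adj G x y → Neighbours F x y
    adjacent⁺ {x} xy with reach-from-edge a b x
    ... | inj₁ (_ , r) with adj⇒link {m = nothing} r xy
    ... | inj₁ l                    = inj₁ (left l)
    ... | inj₂ (inj₁ l)             = inj₂ (inj₁ (left l))
    -- The edge between `a` and `b` is the only one that is not a parent link; it joins the two
    -- roots.
    ... | inj₂ (inj₂ (refl , refl)) = inj₂ (inj₂ (Adj-irrefl xy , left (here refl) , right (here refl)))
    adjacent⁺ {x} xy | inj₂ (_ , r) with adj⇒link {m = nothing} r xy
    ... | inj₁ l                    = inj₁ (right l)
    ... | inj₂ (inj₁ l)             = inj₂ (inj₁ (right l))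
    ... | inj₂ (inj₂ (refl , refl)) = inj₂ (inj₂ (Adj-irrefl xy , right (here refl) , left (here refl)))
    either : ∀ {m x} → (m , x) ∈ linksF nothing F →
      (m ≡ nothing × (x ≡ a ⊎ x ≡ b)) ⊎ (∃[ q ] (m ≡ just q × Adj G q x))
    either l with ∈-++⁻ (linksT nothing (branch a b)) l
    ... | inj₁ l₁ with link⇒adj a b l₁
    ... | inj₁ (eq , eq′) = inj₁ (eq , inj₂ eq′)
    ... | inj₂ adj = inj₂ adj
    either l | inj₂ l₂ with link⇒adj b a (∈-++[]⁻ l₂)
    ... | inj₁ (eq , eq′) = inj₁ (eq , inj₁ eq′)
    ... | inj₂ adj = inj₂ adj
    link : ∀ {x y} → (just x , y) ∈ linksF nothing F → Adj G x y
    link l with either l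
    ... | inj₂ (_ , refl , xy) = xy
    is-root : ∀ {x} → (nothing , x) ∈ linksF nothing F → x ≡ a ⊎ x ≡ b
    is-root l with either l
    ... | inj₁ (_ , eq) = eq
    adjacent⁻ : ∀ {x y} → Neighbours F x y → Adj G x y
    adjacent⁻ (inj₁ l)        = link l
    adjacent⁻ (inj₂ (inj₁ l)) = Adj-sym (link l)
    adjacent⁻ (inj₂ (inj₂ (x≢y , l , l′))) with is-root l | is-root l′
    ... | inj₁ refl | inj₁ refl = contradiction refl x≢y
    ... | inj₁ refl | inj₂ refl = ab
    ... | inj₂ refl | inj₁ refl = Adj-sym ab
    ... | inj₂ refl | inj₂ refl = contradiction refl x≢y

  size-sum : ∀ {a b} → Adj G a b → size a b + size b a ≡ n
  size-sum {a} {b} ab = begin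
    size a b + size b a              ≡⟨ cong (size a b +_) (cong length (++-identityʳ (flatT (branch b a)))) ⟨
    size a b + length (flatT (branch b a) ++ []) ≡⟨ length-++ (flatT (branch a b)) ⟨
    length (flatF (edgeForest a b))  ≡⟨ ≤-antisym
      (length-≤-⊆ unique (λ {x} _ → ∈-allFin x))
      (length-≤-⊆ (Uniqueₚ.allFin⁺ n) (λ {x} _ → complete x)) ⟩
    length (allFin n)                ≡⟨ length-tabulate id ⟩
    n                                ∎
    where
    open ≡-Reasoning
    open Presents (edgeForest-presents ab)

  -- Centroids

  -- By `size-sum` this is the usual centroid condition: no component left after removing v has more
  -- than n/2 vertices.
  Light : V → Set
  Light v = ∀ {w} → Adj G v w → size v w ≤ size w v

  -- Descend into a child whose side of the edge is strictly heavier. The side left behind is then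
  -- never too heavy, which is the condition carried along; at the initial root it is vacuous.
  light-exists : V → ∃[ c ] Light c
  light-exists r = dart-induction (λ p v → (Adj G v p → size v p ≤ size p v) → ∃[ c ] Light c) step r r
    (λ rr → contradiction refl (Adj-irrefl rr))
    where
    step : ∀ p v → (∀ {w} → w ∈ children p v → (Adj G w v → size w v ≤ size v w) → ∃[ c ] Light c) →
      (Adj G v p → size v p ≤ size p v) → ∃[ c ] Light c
    step p v ih back with any? (λ w → size w v <? size v w) (children p v)
    ... | yes heavy with find heavy
    ... | w , w∈ , lt = ih w∈ (λ _ → <⇒≤ lt)
    step p v ih back | no ¬heavy = v , light
      where
      light : Light v
      light {w} vw with w ≟ᶠ p
      ... | yes refl = back vw
      ... | no w≢p   = ≮⇒≥ (λ lt → ¬heavy (lose (∈-children⁺ vw w≢p) lt))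

  Balanced : V → V → Set
  Balanced v w = Adj G v w × size v w ≡ size w v

  Balanced-sym : ∀ {v w} → Balanced v w → Balanced w v
  Balanced-sym (vw , eq) = Adj-sym vw , sym eq

  -- Far sides shrink strictly along the walk from c to c′. If its first and last edges differ,
  -- lightness at both ends makes both sides of the last edge too small to add up to n.
  light-unique : ∀ {c c′} → Light c → Light c′ → c ≡ c′ ⊎ Balanced c c′
  light-unique {c} {c′} lc lc′ with reach-from-vertex c c′
  ... | q , r with reach-uncons r
  ... | inj₁ (_ , eq) = inj₁ eq
  ... | inj₂ (w , w∈ , r′) with proj₁ (∈-children⁻ w∈)
  ... | cw with size-reach r′
  ... | inj₁ (refl , refl) = inj₂ (cw , ≤-antisym (lc cw) (lc′ (Adj-sym cw)))
  ... | inj₂ lt = contradiction (trans (size-sum qc′) (sym (size-sum cw))) (<⇒≢ (+-mono-<-≤ lt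
      (≤-trans (lc′ (Adj-sym qc′)) (≤-trans (<⇒≤ lt) (lc cw)))))
    where qc′ = reach-adj cw r′

  -- Otherwise each of the two half-size branches would be strictly smaller than the other.
  balanced-unique : ∀ {v w w′} → Balanced v w → Balanced v w′ → w ≡ w′
  balanced-unique {v} {w} {w′} (vw , eq) (vw′ , eq′) with w ≟ᶠ w′
  ... | yes w≡w′ = w≡w′
  ... | no w≢w′  = contradiction
    (subst (size v w <_) (sym eq′) (size-child (∈-children⁺ vw w≢w′)))
    (<-asym (subst (size v w′ <_) (sym eq) (size-child (∈-children⁺ vw′ (λ e → w≢w′ (sym e))))))

  -- Automorphisms

  inverse : Automorphism G → Automorphism G
  inverse σ = record
    { to = from σ ; from = to σ ; to-from = from-to σ ; from-to = to-from σ
    ; pres = λ u v → trans (sym (pres σ (from σ u) (from σ v))) (cong₂ (adj G) (to-from σ u) (to-from σ v)) }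

  to-injective : (σ : Automorphism G) → ∀ {u v} → to σ u ≡ to σ v → u ≡ v
  to-injective σ {u} {v} eq = trans (sym (from-to σ u)) (trans (cong (from σ) eq) (from-to σ v))

  to-adj : (σ : Automorphism G) → ∀ {u v} → Adj G u v → Adj G (to σ u) (to σ v)
  to-adj σ {u} {v} uv = trans (pres σ u v) uv

  to-children : (σ : Automorphism G) → ∀ {p v w} → w ∈ children p v → to σ w ∈ children (to σ p) (to σ v)
  to-children σ w∈ with ∈-children⁻ w∈
  ... | vw , w≢p = ∈-children⁺ (to-adj σ vw) (w≢p ∘ to-injective σ)

  to-reach : (σ : Automorphism G) → ∀ {p v q x} → Reach p v q x → Reach (to σ p) (to σ v) (to σ q) (to σ x)
  to-reach σ start    = start
  to-reach σ (r ▷ y∈) = to-reach σ r ▷ to-children σ y∈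

  children-↭ : (σ : Automorphism G) → ∀ p v →
    children (to σ p) (to σ v) ↭ map (to σ) (children p v)
  children-↭ σ p v = ∼bag⇒↭ (unique∧set⇒bag (children-unique _ _)
    (Uniqueₚ.map⁺ (to-injective σ) (children-unique p v)) (mk⇔ there′ back))
    where
    there′ : ∀ {w} → w ∈ children (to σ p) (to σ v) → w ∈ map (to σ) (children p v)
    there′ {w} w∈ = subst (_∈ map (to σ) (children p v)) (to-from σ w) (∈-map⁺ (to σ)
      (subst₂ (λ q x → from σ w ∈ children q x) (from-to σ p) (from-to σ v) (to-children (inverse σ) w∈)))
    back : ∀ {w} → w ∈ map (to σ) (children p v) → w ∈ children (to σ p) (to σ v)
    back w∈ with ∈-map⁻ (to σ) w∈
    ... | w′ , w′∈ , refl = to-children σ w′∈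

  size-≤ : (σ : Automorphism G) → ∀ p v → size p v ≤ size (to σ p) (to σ v)
  size-≤ σ p v = length-≤-injective (λ x y → to σ x ≡ y) (branch-unique p v)
    (λ x∈ → _ , reach⇒∈ _ _ (to-reach σ (proj₂ (∈⇒reach p v x∈))) , refl)
    (λ e e′ → to-injective σ (trans e (sym e′)))

  size-invariant : (σ : Automorphism G) → ∀ p v → size (to σ p) (to σ v) ≡ size p v
  size-invariant σ p v = ≤-antisym
    (subst₂ (λ q x → size (to σ p) (to σ v) ≤ size q x) (from-to σ p) (from-to σ v)
      (size-≤ (inverse σ) (to σ p) (to σ v)))
    (size-≤ σ p v)

  light-invariant : (σ : Automorphism G) → ∀ {c} → Light c → Light (to σ c)
  light-invariant σ {c} lc {w} cw = subst₂ _≤_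
    (trans (sym (size-invariant σ c w′)) (cong (size (to σ c)) (to-from σ w)))
    (trans (sym (size-invariant σ w′ c)) (cong (λ x → size x (to σ c)) (to-from σ w)))
    (lc c-w′)
    where
    w′ = from σ w
    c-w′ : Adj G c w′
    c-w′ = subst (λ x → Adj G x w′) (from-to σ c) (to-adj (inverse σ) cw)

  balanced-invariant : (σ : Automorphism G) → ∀ {v w} → Balanced v w → Balanced (to σ v) (to σ w)
  balanced-invariant σ {v} {w} (vw , eq) =
    to-adj σ vw , trans (size-invariant σ v w) (trans eq (sym (size-invariant σ w v)))

  module _ {f : V → ℕ} (σ : Automorphism G) (preserves : ∀ v → f (to σ v) ≡ f v) where

    code-unfold : ∀ p v → colourCode f (branch p v) ≡
      pair (f v) (multisetCode (map (colourCode f ∘ branch v) (children p v)))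
    code-unfold p v = trans (cong (colourCode f) (branch-unfold p v)) (cong (pair (f v) ∘ multisetCode)
      (trans (codeF-mapF f (map (branch v) (children p v))) (sym (map-∘ (children p v)))))

    -- σ permutes children, and `multisetCode` ignores their order.
    code-invariant : ∀ p v → colourCode f (branch (to σ p) (to σ v)) ≡ colourCode f (branch p v)
    code-invariant = dart-induction
      (λ p v → colourCode f (branch (to σ p) (to σ v)) ≡ colourCode f (branch p v)) λ p v ih → begin
        colourCode f (branch (to σ p) (to σ v))
          ≡⟨ code-unfold (to σ p) (to σ v) ⟩
        pair (f (to σ v)) (multisetCode (map (colourCode f ∘ branch (to σ v)) (children (to σ p) (to σ v))))
          ≡⟨ cong₂ pair (preserves v) (multisetCode-cong (map⁺ (colourCode f ∘ branch (to σ v)) (children-↭ σ p v))) ⟩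
        pair (f v) (multisetCode (map (colourCode f ∘ branch (to σ v)) (map (to σ) (children p v))))
          ≡⟨ cong (pair (f v) ∘ multisetCode) (map-∘ (children p v)) ⟨
        pair (f v) (multisetCode (map (colourCode f ∘ branch (to σ v) ∘ to σ) (children p v)))
          ≡⟨ cong (pair (f v) ∘ multisetCode) (map-cong-local (All.tabulate ih)) ⟩
        pair (f v) (multisetCode (map (colourCode f ∘ branch v) (children p v)))
          ≡⟨ code-unfold p v ⟨
        colourCode f (branch p v) ∎
      where open ≡-Reasoning

    -- Fixing p and v makes σ permute the children of v; a child and its image have equal codes, so
    -- by rigidity they coincide.
    rigid-branch-fixed : ∀ p v → Rigid (mapT f (branch p v)) → to σ p ≡ p → to σ v ≡ v →
      ∀ {q x} → Reach p v q x → to σ x ≡ x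
    rigid-branch-fixed = dart-induction
      (λ p v → Rigid (mapT f (branch p v)) → to σ p ≡ p → to σ v ≡ v →
        ∀ {q x} → Reach p v q x → to σ x ≡ x) step
      where
      step : ∀ p v → (∀ {w} → w ∈ children p v → Rigid (mapT f (branch v w)) → to σ v ≡ v → to σ w ≡ w →
               ∀ {q x} → Reach v w q x → to σ x ≡ x) →
        Rigid (mapT f (branch p v)) → to σ p ≡ p → to σ v ≡ v → ∀ {q x} → Reach p v q x → to σ x ≡ x
      step p v ih rigid σp σv r with reach-uncons r
      ... | inj₁ (refl , refl) = σv
      ... | inj₂ (w , w∈ , r′) with subst (Rigid ∘ mapT f) (branch-unfold p v) rigid
      ... | node rs uniq =
        ih w∈ (All-mapF⁻ f rs (∈-map⁺ (branch v) w∈)) σv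
          (Unique-map-injective (colourCode f ∘ branch v) uniq′ σw∈ w∈
            (trans (cong (λ x → colourCode f (branch x (to σ w))) (sym σv)) (code-invariant v w))) r′
        where
        uniq′ : Unique (map (colourCode f ∘ branch v) (children p v))
        uniq′ = subst Unique (trans (codeF-mapF f (map (branch v) (children p v))) (sym (map-∘ (children p v)))) uniq
        σw∈ : to σ w ∈ children p v
        σw∈ = subst₂ (λ q x → to σ w ∈ children q x) σp σv (to-children σ w∈)

  -- Rooting at the centroid

  Representing : Forest V → Set
  Representing F = Presents F G × (∀ {f} → RigidF (mapF f F) → Distinguishing G f)

  fixed-vertex-represents : ∀ {c} → (∀ σ → to σ c ≡ c) → Representing (vertexForest c)
  fixed-vertex-represents {c} c-fixed = vertexForest-presents c , distinguishing
    where
    distinguishing : ∀ {f} → RigidF (mapF f (vertexForest c)) → Distinguishing G f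
    distinguishing (rigid ∷ [] , _) σ preserves x =
      rigid-branch-fixed σ preserves c c rigid (c-fixed σ) (c-fixed σ) (proj₂ (reach-from-vertex c x))

  fixed-edge-represents : ∀ {a b} → Adj G a b →
    (∀ σ → (to σ a ≡ a × to σ b ≡ b) ⊎ (to σ a ≡ b × to σ b ≡ a)) → Representing (edgeForest a b)
  fixed-edge-represents {a} {b} ab fixed = edgeForest-presents ab , distinguishing
    where
    distinguishing : ∀ {f} → RigidF (mapF f (edgeForest a b)) → Distinguishing G f
    distinguishing {f} (rigid ∷ rigid′ ∷ [] , (a≢b ∷ []) ∷ _) σ preserves x
      with fixed σ | reach-from-edge a b x
    -- Swapping the ends would give the two root branches equal codes, which rigidity of the forest
    -- forbids.
    ... | inj₂ (σa , σb) | _ = contradiction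
      (trans (sym (code-invariant {f} σ preserves a b)) (cong₂ (λ q y → colourCode f (branch q y)) σa σb)) a≢b
    ... | inj₁ (σa , σb) | inj₁ (_ , r) = rigid-branch-fixed σ preserves a b rigid σa σb r
    ... | inj₁ (σa , σb) | inj₂ (_ , r) = rigid-branch-fixed σ preserves b a rigid′ σb σa r

  light-fixed : ∀ {c} → Light c → (∀ {w} → ¬ Balanced c w) → ∀ σ → to σ c ≡ c
  light-fixed lc ¬balanced σ =
    [ sym , (λ bal → contradiction bal ¬balanced) ]′ (light-unique lc (light-invariant σ lc))

  -- The image of c is light, hence c or its unique balanced partner w; the image of w is then the
  -- partner of that vertex.
  balanced-fixed : ∀ {c w} → Light c → Balanced c w →
    ∀ σ → (to σ c ≡ c × to σ w ≡ w) ⊎ (to σ c ≡ w × to σ w ≡ c)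
  balanced-fixed {c} {w} lc bal σ =
    [ (λ c≡σc → inj₁ (sym c≡σc , partner bal c≡σc))
    , (λ bal′ → let w≡σc = balanced-unique bal bal′
                in inj₂ (sym w≡σc , partner (Balanced-sym bal) w≡σc))
    ]′ (light-unique lc (light-invariant σ lc))
    where
    partner : ∀ {x y} → Balanced x y → x ≡ to σ c → to σ w ≡ y
    partner bal′ refl = balanced-unique (balanced-invariant σ bal) bal′

  balanced? : ∀ c → (∃[ w ] Balanced c w) ⊎ (∀ {w} → ¬ Balanced c w)
  balanced? c with any? (λ w → size c w ≟ size w c) (children c c)
  ... | yes p = let w , w∈ , eq = find p in inj₁ (w , proj₁ (∈-children⁻ w∈) , eq)
  ... | no ¬p = inj₂ λ { (cw , eq) → ¬p (lose (∈-children⁺ cw (λ e → Adj-irrefl cw (sym e))) eq) }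

  centroid-represents : V → ∃[ F ] Representing F
  centroid-represents r = let c , lc = light-exists r in by-cases lc (balanced? c)
    where
    by-cases : ∀ {c} → Light c → (∃[ w ] Balanced c w) ⊎ (∀ {w} → ¬ Balanced c w) → ∃[ F ] Representing F
    by-cases lc (inj₁ (w , bal)) = _ , fixed-edge-represents (proj₁ bal) (balanced-fixed lc bal)
    by-cases lc (inj₂ ¬bal)      = _ , fixed-vertex-represents (light-fixed lc ¬bal)

-- From the palette to arbitrary lists and back

zip-map : ∀ {A B} {S : A → B → Set} (f : A → B) → (∀ v → S v (f v)) → ∀ ts → ZipF S ts (mapF f ts)
zip-map f s []               = []
zip-map f s (node v us ∷ ts) = node (s v) (zip-map f s us) ∷ zip-map f s ts

palette : ℕ → List ℕ
palette = applyUpTo suc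

∈-palette⁺ : ∀ {k a} → 1 ≤ a → a ≤ k → a ∈ palette k
∈-palette⁺ {a = suc a} _ a≤k = ∈-applyUpTo⁺ suc a≤k

∈-palette⁻ : ∀ {k a} → a ∈ palette k → 1 ≤ a × a ≤ k
∈-palette⁻ {k} a∈ with ∈-applyUpTo⁻ suc a∈
... | i , i<k , refl = s≤s z≤n , i<k

represented⇒k-lists : ∀ {n} {G : Graph n} {F} → Presents F G →
  (∀ {f} → RigidF (mapF f F) → Distinguishing G f) → ∀ {k} → HasDistKColoring G k → AllKListsDist G k
represented⇒k-lists {F = F} presents rigid⇒dist {k} (φ , φ-colours , φ-dist) L L-lists
  with rigid-transfer (palette k) L (proj₁ ∘ L-lists)
         (λ v → ≤-reflexive (trans (length-applyUpTo suc k) (sym (proj₂ (L-lists v)))))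
         (zip-map φ (λ v → ∈-palette⁺ (proj₁ (φ-colours v)) (proj₂ (φ-colours v))) F)
         (distinguishing⇒rigid presents φ-dist)
-- The coloured copy `us` becomes a colouring of the vertices; the default 0 is harmless because the
-- forest contains every vertex.
... | us , z , rigid with relabelF _≟ᶠ_ 0 (Presents.unique presents) z
... | f , refl , f∈L = f , (λ v → f∈L (Presents.complete presents v)) , rigid⇒dist rigid

k-colouring⇒k-lists : ∀ {n} (T : Graph n) → IsTree T → ∀ {k} → HasDistKColoring T k → AllKListsDist T k
k-colouring⇒k-lists {suc n} T (_ , connected , acyclic) =
  let _ , presents , rigid⇒dist = TreeGraph.centroid-represents T connected acyclic zero
  in represented⇒k-lists presents rigid⇒dist

k-lists⇒k-colouring : ∀ {n} (G : Graph n) {k} → AllKListsDist G k → HasDistKColoring G k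
k-lists⇒k-colouring G {k} lists with lists (λ _ → palette k) (λ _ →
    Uniqueₚ.applyUpTo⁺₁ suc k (λ i<j _ eq → <⇒≢ i<j (suc-injective eq)) , length-applyUpTo suc k)
... | f , f∈ , dist = f , (λ v → ∈-palette⁻ (f∈ v)) , dist

IsMinimum-⇔ : ∀ {P Q : ℕ → Set} → (∀ {k} → P k → Q k) → (∀ {k} → Q k → P k) →
  ∀ {k} → IsMinimum P k → IsMinimum Q k
IsMinimum-⇔ f g (p , min) = f p , λ j q → min j (g q)

theorem1 : ∀ {n : ℕ} (T : Graph n) → IsTree T → ∀ (k : ℕ) →
    (DistNumberIs T k → ListDistNumberIs T k) × (ListDistNumberIs T k → DistNumberIs T k)
theorem1 T tree k =
  IsMinimum-⇔ (k-colouring⇒k-lists T tree) (k-lists⇒k-colouring T) ,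
  IsMinimum-⇔ (k-lists⇒k-colouring T) (k-colouring⇒k-lists T tree)
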